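{- There is an absolute constant $C>0$ such that the following holds. Let $G$ be a graph with $n$ vertices and average degree $d\ge 2$. Then $$f(G)\ge \frac{d}{2^{C\sqrt{\log d\,\log\log n}}},$$ i.e. $f(G)\ge d/2^{O(\sqrt{\log d\log\log n})}$.
   Context: An edge-ordering of a graph $G$ is a total order $\le_G$ on $E(G)$. A path is monotone if its consecutive edges form a monotone sequence with respect to $\le_G$. The altitude $f(G)$ is the maximum $k$ such that every edge-ordering of $G$ contains a monotone path of length $k$ (length = number of edges). All logarithms are base 2. -}

module Defs where

open import Data.Fin.Base as Fin using (Fin; suc; inject₁)
open import Data.Integer.Base as ℤ using (ℤ; +_; -[1+_])
open import Data.List.Base using (length; filter; map; sum; allFin)
open import Data.Nat.Base as ℕ using (ℕ; suc; NonZero)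
open import Data.Product.Base using (_×_; ∃-syntax)
open import Data.Rational.Base
  using (ℚ; 0ℚ; ½; _/_; _*_; _<_; _≤_; ↥_; ↧ₙ_; +-*-rawSemiring)
open import Data.Sum.Base using (_⊎_)
open import Function.Definitions using (Injective)
open import Level using (0ℓ)
open import Relation.Binary.Core using (Rel)
open import Relation.Binary.Definitions
  using (Decidable; Symmetric; Monotonic₁; Antitonic₁)
open import Relation.Binary.PropositionalEquality.Core using (_≡_)
open import Relation.Binary.Structures using (IsTotalOrder)
open import Relation.Nullary.Negation.Core using (¬_)
open import Relation.Unary using (Pred)

open import Algebra.Definitions.RawSemiring +-*-rawSemiring using (_^_)

------------------------------------------------------------------------
-- Finite simple graphs

record Graph (n : ℕ) : Set₁ where
  field
    Adj    : Rel (Fin n) 0ℓ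
    adj?   : Decidable Adj
    sym    : Symmetric Adj
    irrefl : ∀ {v} → ¬ Adj v v

module _ {n : ℕ} (G : Graph n) where
  open Graph G

  degree : Fin n → ℕ
  degree v = length (filter (adj? v) (allFin n))

  averageDegree : .{{NonZero n}} → ℚ
  averageDegree = + sum (map degree (allFin n)) / n

  -- An unordered pair of adjacent vertices is stored with its smaller end
  -- first; the proof fields are irrelevant, so that _≡_ on edges is
  -- equality of the underlying pairs.
  record Edge : Set where
    constructor mkEdge
    field
      lo hi     : Fin n
      .lo<hi    : lo Fin.< hi
      .adjacent : Adj lo hi

  Joins : Edge → Fin n → Fin n → Set
  Joins e u v = (lo ≡ u × hi ≡ v) ⊎ (lo ≡ v × hi ≡ u)
    where open Edge e

  record EdgeOrdering : Set₁ where
    field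
      _≤ᴱ_         : Rel Edge 0ℓ
      isTotalOrder : IsTotalOrder _≡_ _≤ᴱ_

  record Path (k : ℕ) : Set where
    field
      vertex   : Fin (suc k) → Fin n
      distinct : Injective _≡_ _≡_ vertex
      edge     : Fin k → Edge
      joins    : ∀ i → Joins (edge i) (vertex (inject₁ i)) (vertex (suc i))

  IsMonotone : EdgeOrdering → ∀ {k} → Path k → Set
  IsMonotone O P =
    Monotonic₁ Fin._≤_ _≤ᴱ_ edge ⊎ Antitonic₁ Fin._≤_ _≤ᴱ_ edge
    where
    open EdgeOrdering O
    open Path P

  Unavoidable : ℕ → Set₁
  Unavoidable k = (O : EdgeOrdering) → ∃[ P ] IsMonotone O {k} P

  -- For n ≥ 1 the set of unavoidable lengths contains 0 and is bounded by
  -- n, so exactly one k satisfies this.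
  IsAltitude : ℕ → Set₁
  IsAltitude k = Unavoidable k × (∀ j → Unavoidable j → j ℕ.≤ k)

------------------------------------------------------------------------
-- Real numbers as cuts of ℚ
--
-- A real x is given either by its upper cut { q | x < q } or by its lower
-- cut { q | q < x }.  An operation that is monotone in its (upper-cut)
-- arguments yields an upper cut, and an antitone one yields a lower cut.

UpperCut LowerCut : Set₁
UpperCut = Pred ℚ 0ℓ
LowerCut = Pred ℚ 0ℓ

real : ℚ → UpperCut
real x q = x < q

2^ : ℤ → ℚ
2^ (+ m)    = (+ 2 / 1) ^ m
2^ -[1+ m ] = ½ ^ suc m

-- For r > 0 and q = a / b, these say log₂ r ≤ q (that is, r ^ b ≤ 2 ^ a)
-- and q ≤ log₂ r (that is, 2 ^ a ≤ r ^ b).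
Log≤ Log≥ : ℚ → ℚ → Set
Log≤ r q = r ^ ↧ₙ q ≤ 2^ (↥ q)
Log≥ r q = 2^ (↥ q) ≤ r ^ ↧ₙ q

-- Meant for x > 0.
log₂ : UpperCut → UpperCut
log₂ x q = ∃[ r ] x r × Log≤ r q

exp₂ : UpperCut → UpperCut
exp₂ x q = 0ℚ < q × (∃[ r ] x r × Log≥ q r)

-- Meant for x ≥ 0.
√ : UpperCut → UpperCut
√ x q = 0ℚ < q × x (q * q)

-- Meant for x, y ≥ 0.
infixl 7 _·_
_·_ : UpperCut → UpperCut → UpperCut
(x · y) q = ∃[ r ] ∃[ s ] x r × y s × r * s ≤ q

-- Meant for d, y > 0: if q < d / y then q * r ≤ d for some rational r > y,
-- and conversely q * r ≤ d with r > y gives q ≤ d / r < d / y.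
infixl 7 _÷_
_÷_ : ℚ → UpperCut → LowerCut
(d ÷ y) q = ∃[ r ] y r × q * r ≤ d

infix 4 _≥ᴿ_
_≥ᴿ_ : ℚ → LowerCut → Set
f ≥ᴿ x = ∀ q → x q → q ≤ f

fromℕ : ℕ → ℚ
fromℕ m = + m / 1

{-# OPTIONS --safe #-}
module Submission where

-- Stamp every edge with its rank in the ordering.  Call a vertex v robust at
-- time τ, at level j, if for every choice of r_j forbidden vertices some monotone
-- path with k_j edges, all later than τ, starts at v and avoids them.  The
-- induction shows that every set of more than D_j n edges contains an edge whose
-- two ends are both robust right after it, where k_{j+1} ≈ ℓ k_j while D_{j+1} is
-- D_j ℓ up to a polylogarithmic factor.
--
-- For one-edge paths, drop the last few edges at every vertex.  For the step, say
-- that an edge is good if ℓ robust hops can be concatenated from either end; the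
-- induction hypothesis, applied to the edges of each exact value y < ℓ, leaves at
-- most ℓ D_j n bad edges.  Forbidding a vertex set F creates further bad edges.
-- If F* maximises #bad(F) − 2 deg(F), then beyond F* a set X creates at most
-- 2 deg(X) new bad edges.  Restrict to edges between two dyadic degree classes and
-- to those with many later good edges at both ends.  From such an edge at z, the
-- neighbours x of z carry more good edges than the forbidden set can destroy, so
-- one may step to some x and climb ℓ hops from there.
--
-- Iterating gives ℓ^k ≤ f once d exceeds (c log n)^{O(k)} ℓ^{k+1}, and
-- k ≈ √(log d / log log n) balances the losses.

open import Defs
open import Data.Nat.Base using (ℕ; NonZero)
open import Data.Product.Base using (_×_; ∃-syntax)

-- A chain of ℓ hops of k_j edges only has to dodge its own past, so tolerating r_j = ℓ k_j
-- forbidden vertices is enough to concatenate. The obstacle is to reproduce such a tolerance one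
-- level up: the bad edges depend on the forbidden set, and that set is chosen only after the
-- starting edge. Saturation resolves this by fixing F* beforehand.
--
-- The weight 2 in the potential beats the coefficient 1 with which forbidding F destroys the edges
-- at F. From 2 deg(F*) ≤ #bad(F*) and #bad(F*) ≤ deg(F*) + ℓ D n it follows that #bad(F*) ≤ 2 ℓ D
-- n, so F* itself is cheap; any later damage is charged to the degrees of the newly forbidden
-- vertices.
--
-- Looking two edges ahead between classes of degrees about a and b gives about ab/κ² continuations,
-- whereas r further vertices spoil only O(r(a + b)) of them. The product wins once a and b are
-- large compared with κ² r, and density forces this: a class of small degree cannot carry enough
-- edges.

module MonotonePaths where

  open import Data.Bool.Base using (Bool; true; false; T; not; _∧_; _∨_; if_then_else_)
  open import Data.Bool.Properties using (∧-zeroʳ; ∧-identityʳ; T?)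
  open import Data.Empty using (⊥-elim)
  open import Data.Fin.Base as Fin using (Fin; zero; suc; toℕ; inject₁)
  open import Data.Fin.Properties as Finₚ using (any?; suc-injective; toℕ-inject₁; toℕ-fromℕ; toℕ-injective)
    renaming (_≟_ to _≟ᶠ_)
  open import Data.List.Base
    using (List; []; _∷_; _++_; length; filter; map; tabulate; allFin; cartesianProduct; lookup)
  open import Data.List.Membership.Propositional using (_∈_; _∉_)
  open import Data.List.Membership.Propositional.Properties using (∈-++⁺ˡ; ∈-lookup)
  open import Data.List.Properties using (map-tabulate; length-++; filter-++)
  open import Data.List.Relation.Binary.Permutation.Propositional using (↭-sym; ↭⇒↭ₛ)
  open import Data.List.Relation.Binary.Permutation.Propositional.Properties using (↭-length)
  import Data.List.Relation.Binary.Permutation.Setoid.Properties as SetoidPerm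
  open import Data.List.Relation.Unary.All as All using (All; []; _∷_)
  open import Data.List.Relation.Unary.All.Properties using (all-filter)
  open import Data.List.Relation.Unary.AllPairs using (AllPairs; []; _∷_)
  open import Data.List.Relation.Unary.Any using (here; there)
  open import Data.List.Relation.Unary.Linked.Properties using (Linked⇒AllPairs)
  open import Data.List.Relation.Unary.Unique.Propositional using (Unique)
  open import Data.List.Relation.Unary.Unique.Propositional.Properties using (allFin⁺; filter⁺; cartesianProduct⁺)
  import Data.List.Sort as Sort
  open import Data.Nat.Base
  open import Data.Nat.DivMod using (m/n*n≤m; m%n<n; m≡m%n+[m/n]*n)
  open import Data.Nat.ListAction using () renaming (sum to sumℓ)
  open import Data.Nat.Properties hiding (suc-injective)
  open import Data.Nat.Tactic.RingSolver using (solve-∀)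
  open import Data.Product.Base using (∃; _,_; proj₁; proj₂)
  open import Data.Sum.Base using (_⊎_; inj₁; inj₂; [_,_])
  open import Data.Unit.Base using (⊤; tt)
  open import Function.Base using (_∘_; id)
  open import Level using (0ℓ)
  open import Relation.Binary.Bundles using (DecTotalOrder)
  open import Relation.Binary.Definitions using (tri<; tri≈; tri>)
  open import Relation.Binary.PropositionalEquality hiding ([_])
  open import Relation.Binary.Structures using (IsTotalOrder)
  open import Relation.Nullary.Decidable using (Dec; yes; no; does; _×-dec_; _⊎-dec_; ¬?; map′; recompute)
  open import Relation.Nullary.Negation.Core using (¬_; contradiction)
  open import Relation.Unary using (Pred; Decidable)
  open import Algebra.Properties.Semiring.Sum +-*-semiring
    using (sum; ∑-comm; ∑-distrib-+; *-distribˡ-sum; *-distribʳ-sum; sum-cong-≗)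

  -- Counting by sums of indicators

  ι : Bool → ℕ
  ι true  = 1
  ι false = 0

  ι-T : ∀ {b} → T b → ι b ≡ 1
  ι-T {true} _ = refl

  ι≤1 : ∀ b → ι b ≤ 1
  ι≤1 true  = ≤-refl
  ι≤1 false = z≤n

  ι-mono : ∀ {b c} → (T b → T c) → ι b ≤ ι c
  ι-mono {true}  {true}  _ = ≤-refl
  ι-mono {true}  {false} f = ⊥-elim (f tt)
  ι-mono {false} {c}     _ = z≤n

  ι≤ : ∀ {b k} → (T b → 1 ≤ k) → ι b ≤ k
  ι≤ {true}  f = f tt
  ι≤ {false} _ = z≤n

  ι-pos : ∀ {b k} → k < ι b → T b
  ι-pos {true} _ = tt

  does⇒ : ∀ {P : Set} (d : Dec P) → T (does d) → P
  does⇒ (yes p) _ = p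

  ⇒does : ∀ {P : Set} (d : Dec P) → P → T (does d)
  ⇒does (yes _) _ = tt
  ⇒does (no ¬p) p = ¬p p

  T-not : ∀ {b} → ¬ T b → T (not b)
  T-not {true}  f = f tt
  T-not {false} _ = tt

  not-T : ∀ {b} → T (not b) → ¬ T b
  not-T {false} _ ()

  ∧⁺ : ∀ {b c} → T b → T c → T (b ∧ c)
  ∧⁺ {true} _ q = q

  ∧⁻ : ∀ {b c} → T (b ∧ c) → T b × T c
  ∧⁻ {true} q = tt , q

  ∨⁺ˡ : ∀ {b c} → T b → T (b ∨ c)
  ∨⁺ˡ {true} _ = tt

  ∨⁺ʳ : ∀ {b c} → T c → T (b ∨ c)
  ∨⁺ʳ {true}  _ = tt
  ∨⁺ʳ {false} q = q

  ∨⁻ : ∀ {b c} → T (b ∨ c) → T b ⊎ T c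
  ∨⁻ {true}  _ = inj₁ tt
  ∨⁻ {false} q = inj₂ q

  sum-mono : ∀ {n} {f g : Fin n → ℕ} → (∀ i → f i ≤ g i) → sum f ≤ sum g
  sum-mono {zero}  h = z≤n
  sum-mono {suc n} h = +-mono-≤ (h zero) (sum-mono (h ∘ suc))

  sum-const : ∀ n c → sum {n} (λ _ → c) ≡ n * c
  sum-const zero    c = refl
  sum-const (suc n) c = cong (c +_) (sum-const n c)

  term≤sum : ∀ {n} (f : Fin n → ℕ) i → f i ≤ sum f
  term≤sum f zero    = m≤m+n _ _
  term≤sum f (suc i) = ≤-trans (term≤sum (f ∘ suc) i) (m≤n+m _ (f zero))

  -- The averaging principle behind the choices of edges, neighbours and degree classes: a strict
  -- comparison of totals produces an explicit index.
  sum-< : ∀ {n} (f g : Fin n → ℕ) → sum f < sum g → ∃ λ i → f i < g i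
  sum-< {suc n} f g lt with f zero <? g zero
  ... | yes p = zero , p
  ... | no ¬p with sum-< (f ∘ suc) (g ∘ suc) tail<
    where
    tail< : sum (f ∘ suc) < sum (g ∘ suc)
    tail< = +-cancelˡ-< (f zero) _ _
      (<-≤-trans lt (+-monoˡ-≤ (sum (g ∘ suc)) (≮⇒≥ ¬p)))
  ...   | i , p = suc i , p

  # : ∀ {m} → (Fin m → Bool) → ℕ
  # P = sum (λ i → ι (P i))

  #-mono : ∀ {m} {P Q : Fin m → Bool} → (∀ i → T (P i) → T (Q i)) → # P ≤ # Q
  #-mono h = sum-mono (λ i → ι-mono (h i))

  #≤ : ∀ {m} (P : Fin m → Bool) → # P ≤ m
  #≤ {m} P = ≤-trans (sum-mono (ι≤1 ∘ P)) (≤-reflexive (trans (sum-const m 1) (*-identityʳ m)))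

  #-none : ∀ {m} (P : Fin m → Bool) → (∀ i → ¬ T (P i)) → # P ≤ 0
  #-none {m} P none = ≤-trans (sum-mono λ i → ι≤ λ p → contradiction p (none i))
    (≤-reflexive (trans (sum-const m 0) (*-zeroʳ m)))

  #-unique : ∀ {m} (P : Fin m → Bool) → (∀ i j → T (P i) → T (P j) → i ≡ j) → # P ≤ 1
  #-unique {zero}  P u = z≤n
  #-unique {suc m} P u with P zero in eq
  ... | false = #-unique (P ∘ suc) (λ i j p q → suc-injective (u _ _ p q))
  ... | true  = s≤s (#-none (P ∘ suc) λ i p →
    contradiction (u zero (suc i) (subst T (sym eq) tt) p) λ ())

  #-union : ∀ {m} {P Q R : Fin m → Bool} →
            (∀ i → T (P i) → T (Q i) ⊎ T (R i)) → # P ≤ # Q + # R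
  #-union {P = P} {Q} {R} h = ≤-trans (sum-mono pointwise)
      (≤-reflexive (∑-distrib-+ (ι ∘ Q) (ι ∘ R)))
    where
    pointwise : ∀ i → ι (P i) ≤ ι (Q i) + ι (R i)
    pointwise i = ι≤ λ p → [h] (h i p)
      where
      [h] : T (Q i) ⊎ T (R i) → 1 ≤ ι (Q i) + ι (R i)
      [h] (inj₁ q) = ≤-trans (≤-reflexive (sym (ι-T q))) (m≤m+n _ _)
      [h] (inj₂ r) = ≤-trans (≤-reflexive (sym (ι-T r))) (m≤n+m _ (ι (Q i)))

  #-disjoint : ∀ {m} {P Q R : Fin m → Bool} → (∀ i → T (P i) → T (R i)) →
               (∀ i → T (Q i) → T (R i)) → (∀ i → T (P i) → ¬ T (Q i)) →
               # P + # Q ≤ # R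
  #-disjoint {P = P} {Q} {R} f g d =
    ≤-trans (≤-reflexive (sym (∑-distrib-+ (ι ∘ P) (ι ∘ Q)))) (sum-mono pointwise)
    where
    pointwise : ∀ i → ι (P i) + ι (Q i) ≤ ι (R i)
    pointwise i with P i in eqP | Q i in eqQ
    ... | false | q     = subst (λ b → ι b ≤ ι (R i)) eqQ (ι-mono (g i))
    ... | true  | false = subst (λ b → ι b ≤ ι (R i)) eqP (ι-mono (f i))
    ... | true  | true  = contradiction (subst T (sym eqQ) tt) (d i (subst T (sym eqP) tt))

  after : ∀ {m} → (Fin m → Bool) → Fin m → ℕ
  after P i = # (λ j → P j ∧ (toℕ i <ᵇ toℕ j))

  -- Induction from the front: index zero is counted only if fewer than `q` members of `P` follow
  -- it, and then all the later ones together still number fewer than `q`.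
  last-few : ∀ {m} (P : Fin m → Bool) q → # (λ i → P i ∧ (after P i <ᵇ q)) ≤ q
  last-few {zero}  P q = z≤n
  last-few {suc m} P q = begin
    ι (P zero ∧ (after P zero <ᵇ q)) + # (λ i → P (suc i) ∧ (after P (suc i) <ᵇ q))
      ≡⟨ cong₂ _+_ (cong (λ k → ι (P zero ∧ (k <ᵇ q))) after-zero)
           (sum-cong-≗ (λ i → cong (λ k → ι (P (suc i) ∧ (k <ᵇ q))) (after-suc i))) ⟩
    ι (P zero ∧ (# (P ∘ suc) <ᵇ q)) + # (λ i → P (suc i) ∧ (after (P ∘ suc) i <ᵇ q))
      ≤⟨ bound ⟩
    q ∎
    where
    open ≤-Reasoning
    after-zero : after P zero ≡ # (P ∘ suc)
    after-zero = cong₂ _+_ (cong ι (∧-zeroʳ (P zero)))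
      (sum-cong-≗ (λ j → cong ι (∧-identityʳ (P (suc j)))))
    after-suc : ∀ i → after P (suc i) ≡ after (P ∘ suc) i
    after-suc i = cong₂ _+_ (cong ι (∧-zeroʳ (P zero))) refl
    bound : ι (P zero ∧ (# (P ∘ suc) <ᵇ q)) +
            # (λ i → P (suc i) ∧ (after (P ∘ suc) i <ᵇ q)) ≤ q
    bound with P zero ∧ (# (P ∘ suc) <ᵇ q) in eq
    ... | false = last-few (P ∘ suc) q
    ... | true  = <-≤-trans
      (s≤s (#-mono {Q = P ∘ suc} λ i → proj₁ ∘ ∧⁻))
      (<ᵇ⇒< (# (P ∘ suc)) q (proj₂ (∧⁻ {P zero} (subst T (sym eq) tt))))

  -- Monotone paths in a graph with time-stamped edges

  -- The index of an edge is its rank in the edge ordering.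
  record OrderedGraph (n m : ℕ) : Set where
    field
      src tgt  : Fin m → Fin n
      loopless : ∀ e → ¬ src e ≡ tgt e

    Links : Fin m → Fin n → Fin n → Set
    Links e v w = (src e ≡ v × tgt e ≡ w) ⊎ (src e ≡ w × tgt e ≡ v)

    field
      simple : ∀ {e e′ v w} → Links e v w → Links e′ v w → e ≡ e′

  -- Forbidden sets of bounded size form a finite search space. This makes `Val` decidable and lets
  -- `saturate` look for an improving extension.
  anyList? : ∀ {n} k {P : List (Fin n) → Set} → (∀ xs → Dec (P xs)) →
             Dec (∃ λ xs → length xs ≤ k × P xs)
  anyList? zero P? = map′ (λ p → [] , z≤n , p) (λ { ([] , _ , p) → p }) (P? [])
  anyList? (suc k) {P} P? = map′ to from
    (P? [] ⊎-dec any? (λ x → anyList? k (λ xs → P? (x ∷ xs))))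
    where
    to : P [] ⊎ (∃ λ x → ∃ λ xs → length xs ≤ k × P (x ∷ xs)) →
         ∃ λ xs → length xs ≤ suc k × P xs
    to (inj₁ p)                = [] , z≤n , p
    to (inj₂ (x , xs , l , p)) = x ∷ xs , s≤s l , p
    from : (∃ λ xs → length xs ≤ suc k × P xs) →
           P [] ⊎ (∃ λ x → ∃ λ xs → length xs ≤ k × P (x ∷ xs))
    from ([] , _ , p)          = inj₁ p
    from (x ∷ xs , s≤s l , p)  = inj₂ (x , xs , l , p)

  module Hops {n m : ℕ} (G : OrderedGraph n m) where
    open OrderedGraph G public

    open import Data.List.Membership.DecPropositional (_≟ᶠ_ {n}) using (_∈?_) public

    Links? : ∀ e v w → Dec (Links e v w)
    Links? e v w = (src e ≟ᶠ v ×-dec tgt e ≟ᶠ w) ⊎-dec (src e ≟ᶠ w ×-dec tgt e ≟ᶠ v)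

    EdgeSet : Set
    EdgeSet = Fin m → Bool

    State : Set₁
    State = List (Fin n) → Fin n → ℕ → Set

    -- Hop Q k S W v τ is a path of k edges of Q with increasing indices, all at
    -- least τ, that starts at v, enters no vertex of W and ends in S.  W collects
    -- the vertices left behind, so hops can be concatenated without repetition.
    Hop : EdgeSet → ℕ → State → State
    Hop Q zero    S W v τ = S W v τ
    Hop Q (suc k) S W v τ = ∃ λ e → T (Q e) × τ ≤ toℕ e ×
      (∃ λ w → Links e v w × w ∉ W × Hop Q k S (v ∷ W) w (suc (toℕ e)))

    Hop? : ∀ Q k {S : State} → (∀ W v τ → Dec (S W v τ)) → ∀ W v τ → Dec (Hop Q k S W v τ)
    Hop? Q zero    S? W v τ = S? W v τ
    Hop? Q (suc k) S? W v τ = any? λ e → T? (Q e) ×-dec τ ≤? toℕ e ×-dec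
      (any? λ w → Links? e v w ×-dec ¬? (w ∈? W) ×-dec Hop? Q k S? (v ∷ W) w (suc (toℕ e)))

    Hop-map : ∀ {Q Q′ : EdgeSet} {S S′ : State} k → (∀ e → T (Q e) → T (Q′ e)) → ∀ {W v τ} →
              (∀ W′ u σ → length W′ ≡ k + length W → S W′ u σ → S′ W′ u σ) →
              Hop Q k S W v τ → Hop Q′ k S′ W v τ
    Hop-map zero    Q⊆ S⊆ h = S⊆ _ _ _ refl h
    Hop-map (suc k) Q⊆ {W} {v} S⊆ (e , q , t , w , l , w∉ , h) =
      e , Q⊆ e q , t , w , l , w∉ ,
      Hop-map k Q⊆ (λ W′ u σ eq → S⊆ W′ u σ (trans eq (+-suc k (length W)))) h

    Hop-bind : ∀ {Q : EdgeSet} {S : State} a b {W v τ} →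
               Hop Q a (Hop Q b S) W v τ → Hop Q (a + b) S W v τ
    Hop-bind zero    b h = h
    Hop-bind (suc a) b (e , q , t , w , l , w∉ , h) = e , q , t , w , l , w∉ , Hop-bind a b h

    Anywhere : State
    Anywhere _ _ _ = ⊤

    -- A path with at least one edge stops at an end of an edge of `Q`, so whatever holds at all
    -- such ends holds where it stops; hence `suc k`.
    Hop-end : ∀ {Q Q′ : EdgeSet} {S : State} k → (∀ e → T (Q e) → T (Q′ e)) →
              (∀ e v w → T (Q e) → Links e v w → ∀ W → S W w (suc (toℕ e))) →
              ∀ {W v τ} → Hop Q (suc k) Anywhere W v τ → Hop Q′ (suc k) S W v τ
    Hop-end zero    Q⊆ end (e , q , t , w , l , w∉ , _) =
      e , Q⊆ e q , t , w , l , w∉ , end e _ w q l _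
    Hop-end (suc k) Q⊆ end (e , q , t , w , l , w∉ , h) =
      e , Q⊆ e q , t , w , l , w∉ , Hop-end k Q⊆ end h

    Hop-later : ∀ {Q : EdgeSet} k {W v τ τ′} → τ′ ≤ τ →
                Hop Q k Anywhere W v τ → Hop Q k Anywhere W v τ′
    Hop-later zero    τ′≤τ h                = tt
    Hop-later (suc k) τ′≤τ (e , q , t , rest) = e , q , ≤-trans τ′≤τ t , rest

    -- Converts deleted edges into avoided vertices: if no edge of `Q` enters `A`, forbidding `A`
    -- costs the path nothing.
    Hop-avoid : ∀ {Q Q′ : EdgeSet} {A : List (Fin n)} → (∀ e → T (Q e) → T (Q′ e)) →
                (∀ e v w → T (Q e) → Links e v w → w ∉ A) →
                ∀ k {W W′ v τ} → (∀ {x} → x ∈ W′ → x ∈ W ⊎ x ∈ A) →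
                Hop Q k Anywhere W v τ → Hop Q′ k Anywhere W′ v τ
    Hop-avoid Q⊆ av zero    inc h = tt
    Hop-avoid Q⊆ av (suc k) inc (e , q , t , w , l , w∉ , h) =
      e , Q⊆ e q , t , w , l , (λ w∈ → [ w∉ , av e _ w q l ] (inc w∈)) ,
      Hop-avoid Q⊆ av k (λ { (here p) → inj₁ (here p)
                           ; (there p) → [ inj₁ ∘ there , inj₂ ] (inc p) }) h

    Robust : EdgeSet → ℕ → ℕ → Fin n → ℕ → Set
    Robust Q r k v τ = ∀ W → length W ≤ r → Hop Q k Anywhere W v τ

    -- A game value: `y` hops can be made in succession while an adversary names up to `r` forbidden
    -- vertices before each. The state reached discards the vertices left behind, so the value
    -- depends only on vertex and time.
    Val : EdgeSet → ℕ → ℕ → ℕ → Fin n → ℕ → Set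
    Val Q r k zero    v τ = ⊤
    Val Q r k (suc y) v τ = ∀ W → length W ≤ r → Hop Q k (λ _ → Val Q r k y) W v τ

    Val? : ∀ Q r k y v τ → Dec (Val Q r k y v τ)
    Val? Q r k zero    v τ = yes tt
    Val? Q r k (suc y) v τ = map′ to from
      (¬? (anyList? r (λ W → ¬? (hop? W))))
      where
      hop? : ∀ W → Dec (Hop Q k (λ _ → Val Q r k y) W v τ)
      hop? W = Hop? Q k (λ _ → Val? Q r k y) W v τ
      to : ¬ (∃ λ W → length W ≤ r × ¬ Hop Q k (λ _ → Val Q r k y) W v τ) →
           Val Q r k (suc y) v τ
      to none W l with hop? W
      ... | yes h = h
      ... | no ¬h = contradiction (W , l , ¬h) none
      from : Val Q r k (suc y) v τ →
             ¬ (∃ λ W → length W ≤ r × ¬ Hop Q k (λ _ → Val Q r k y) W v τ)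
      from val (W , l , ¬h) = ¬h (val W l)

    Val-mono : ∀ {Q Q′} r k y → (∀ e → T (Q e) → T (Q′ e)) → ∀ {v τ} →
               Val Q r k y v τ → Val Q′ r k y v τ
    Val-mono r k zero    Q⊆ _   = tt
    Val-mono r k (suc y) Q⊆ val W l =
      Hop-map k Q⊆ (λ _ u σ _ → Val-mono r k y Q⊆) (val W l)

    -- The vertices already visited serve as the forbidden set of the next hop.
    unroll : ∀ {Q r k} y {v τ} W → length W + y * k ≤ r →
             Val Q r k y v τ → Hop Q (y * k) Anywhere W v τ
    unroll zero    W l _   = tt
    unroll {Q} {r} {k} (suc y) W l val = Hop-bind k (y * k)
      (Hop-map k (λ _ q → q) continue (val W (≤-trans (m≤m+n (length W) (k + y * k)) l)))
      where
      continue : ∀ W′ u σ → length W′ ≡ k + length W → Val Q r k y u σ →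
                 Hop Q (y * k) Anywhere W′ u σ
      continue W′ u σ eq = unroll y W′ (begin
        length W′ + y * k         ≡⟨ cong (_+ y * k) (trans eq (+-comm k (length W))) ⟩
        length W + k + y * k      ≡⟨ +-assoc (length W) k (y * k) ⟩
        length W + (k + y * k)    ≤⟨ l ⟩
        r                         ∎)
        where open ≤-Reasoning

    -- Incidence, degrees and late edges

    incᵇ : Fin m → Fin n → Bool
    incᵇ e v = does (src e ≟ᶠ v) ∨ does (tgt e ≟ᶠ v)

    linkᵇ : Fin m → Fin n → Fin n → Bool
    linkᵇ e v w = does (Links? e v w)

    Links-sym : ∀ {e v w} → Links e v w → Links e w v
    Links-sym (inj₁ p) = inj₂ p
    Links-sym (inj₂ p) = inj₁ p

    src-inc : ∀ e → T (incᵇ e (src e))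
    src-inc e = ∨⁺ˡ (⇒does (src e ≟ᶠ src e) refl)

    tgt-inc : ∀ e → T (incᵇ e (tgt e))
    tgt-inc e = ∨⁺ʳ {does (src e ≟ᶠ tgt e)} (⇒does (tgt e ≟ᶠ tgt e) refl)

    Links-inc : ∀ {e v w} → Links e v w → T (incᵇ e v)
    Links-inc {e} (inj₁ (refl , _)) = src-inc e
    Links-inc {e} (inj₂ (_ , refl)) = tgt-inc e

    inc-end : ∀ {e v} → T (incᵇ e v) → src e ≡ v ⊎ tgt e ≡ v
    inc-end {e} {v} i with ∨⁻ {does (src e ≟ᶠ v)} i
    ... | inj₁ p = inj₁ (does⇒ (src e ≟ᶠ v) p)
    ... | inj₂ p = inj₂ (does⇒ (tgt e ≟ᶠ v) p)

    inc-Links : ∀ {e v} → T (incᵇ e v) → ∃ λ w → Links e v w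
    inc-Links {e} i with inc-end {e} i
    ... | inj₁ p = tgt e , inj₁ (p , refl)
    ... | inj₂ p = src e , inj₂ (refl , p)

    equals-once : (v : Fin n) → # (λ w → does (v ≟ᶠ w)) ≤ 1
    equals-once v = #-unique _ λ i j p q →
      trans (sym (does⇒ (v ≟ᶠ i) p)) (does⇒ (v ≟ᶠ j) q)

    two-ends : ∀ e → # (incᵇ e) ≤ 2
    two-ends e = ≤-trans
      (#-union {Q = λ v → does (src e ≟ᶠ v)} {R = λ v → does (tgt e ≟ᶠ v)}
         (λ v → ∨⁻ {does (src e ≟ᶠ v)}))
      (+-mono-≤ (equals-once (src e)) (equals-once (tgt e)))

    deg : EdgeSet → Fin n → ℕ
    deg Q v = # (λ e → Q e ∧ incᵇ e v)

    sum-deg : ∀ Q → sum (deg Q) ≤ 2 * # Q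
    sum-deg Q = begin
      sum (λ v → sum (λ e → ι (Q e ∧ incᵇ e v))) ≡⟨ sym (∑-comm λ e v → ι (Q e ∧ incᵇ e v)) ⟩
      sum (λ e → # (λ v → Q e ∧ incᵇ e v))       ≤⟨ sum-mono ends ⟩
      sum (λ e → 2 * ι (Q e))                     ≡⟨ sym (*-distribˡ-sum 2 (ι ∘ Q)) ⟩
      2 * # Q                                     ∎
      where
      open ≤-Reasoning
      ends : ∀ e → # (λ v → Q e ∧ incᵇ e v) ≤ 2 * ι (Q e)
      ends e with Q e
      ... | true  = two-ends e
      ... | false = ≤-reflexive (trans (sum-const n 0) (*-zeroʳ n))

    -- Distinct edges at z lead to distinct neighbours.
    neighbour-sum : ∀ (P : EdgeSet) z (g : Fin n → ℕ) (h : Fin m → ℕ) →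
                    (∀ e x → T (P e) → Links e z x → h e ≤ g x) →
                    sum (λ e → ι (P e ∧ incᵇ e z) * h e) ≤ sum g
    neighbour-sum P z g h h≤g = begin
      sum (λ e → ι (P e ∧ incᵇ e z) * h e)             ≤⟨ sum-mono via ⟩
      sum (λ e → sum (λ x → ι (linkᵇ e z x) * g x))    ≡⟨ ∑-comm (λ e x → ι (linkᵇ e z x) * g x) ⟩
      sum (λ x → sum (λ e → ι (linkᵇ e z x) * g x))    ≤⟨ sum-mono once ⟩
      sum g                                             ∎
      where
      open ≤-Reasoning
      via : ∀ e → ι (P e ∧ incᵇ e z) * h e ≤ sum (λ x → ι (linkᵇ e z x) * g x)
      via e with P e in eq | incᵇ e z in eq′
      ... | false | _     = z≤n
      ... | true  | false = z≤n
      ... | true  | true  with inc-Links {e} (subst T (sym eq′) tt)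
      ...   | x , l = begin
        h e + 0                  ≡⟨ +-identityʳ (h e) ⟩
        h e                      ≤⟨ h≤g e x (subst T (sym eq) tt) l ⟩
        g x                      ≡⟨ sym (+-identityʳ (g x)) ⟩
        1 * g x                  ≡⟨ cong (_* g x) (sym (ι-T (⇒does (Links? e z x) l))) ⟩
        ι (linkᵇ e z x) * g x    ≤⟨ term≤sum (λ x → ι (linkᵇ e z x) * g x) x ⟩
        sum (λ x → ι (linkᵇ e z x) * g x) ∎
      once : ∀ x → sum (λ e → ι (linkᵇ e z x) * g x) ≤ g x
      once x = begin
        sum (λ e → ι (linkᵇ e z x) * g x)  ≡⟨ sym (*-distribʳ-sum (g x) (λ e → ι (linkᵇ e z x))) ⟩
        # (λ e → linkᵇ e z x) * g x        ≤⟨ *-monoˡ-≤ (g x) (#-unique _ λ e e′ p q →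
                                                simple (does⇒ (Links? e z x) p) (does⇒ (Links? e′ z x) q)) ⟩
        1 * g x                            ≡⟨ *-identityˡ (g x) ⟩
        g x                                ∎

    deg≤n : ∀ Q v → deg Q v ≤ n
    deg≤n Q v = begin
      # (λ e → Q e ∧ incᵇ e v)             ≡⟨ sum-cong-≗ (λ e → sym (*-identityʳ (ι (Q e ∧ incᵇ e v)))) ⟩
      sum (λ e → ι (Q e ∧ incᵇ e v) * 1)   ≤⟨ neighbour-sum Q v (λ _ → 1) (λ _ → 1) (λ _ _ _ _ → ≤-refl) ⟩
      sum {n} (λ _ → 1)                    ≡⟨ trans (sum-const n 1) (*-identityʳ n) ⟩
      n                                    ∎
      where open ≤-Reasoning

    lateAt : EdgeSet → (Fin n → ℕ) → Fin m → Fin n → Bool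
    lateAt P q e v = (P e ∧ incᵇ e v) ∧ (after (λ e′ → P e′ ∧ incᵇ e′ v) e <ᵇ q v)

    early : EdgeSet → (Fin n → ℕ) → EdgeSet
    early P q e = P e ∧ not (lateAt P q e (src e) ∨ lateAt P q e (tgt e))

    early⊆ : ∀ P q e → T (early P q e) → T (P e)
    early⊆ P q e = proj₁ ∘ ∧⁻

    -- A dropped edge is among the last `q v` edges at one of its ends `v`; charge it to that end.
    early-bound : ∀ P q → # P ≤ # (early P q) + sum q
    early-bound P q = begin
      # P                                                        ≤⟨ sum-mono split ⟩
      sum (λ e → ι (early P q e) + # (lateAt P q e))             ≡⟨ ∑-distrib-+ (ι ∘ early P q) (λ e → # (lateAt P q e)) ⟩
      # (early P q) + sum (λ e → # (lateAt P q e))               ≡⟨ cong (# (early P q) +_) (∑-comm (λ e v → ι (lateAt P q e v))) ⟩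
      # (early P q) + sum (λ v → # (λ e → lateAt P q e v))       ≤⟨ +-monoʳ-≤ (# (early P q)) (sum-mono few) ⟩
      # (early P q) + sum q                                      ∎
      where
      open ≤-Reasoning
      few : ∀ v → # (λ e → lateAt P q e v) ≤ q v
      few v = last-few (λ e → P e ∧ incᵇ e v) (q v)
      split : ∀ e → ι (P e) ≤ ι (early P q e) + # (lateAt P q e)
      split e = ι≤ λ p → cases p (T? (lateAt P q e (src e))) (T? (lateAt P q e (tgt e)))
        where
        hit : ∀ v → T (lateAt P q e v) → 1 ≤ ι (early P q e) + # (lateAt P q e)
        hit v l = ≤-trans (≤-trans (≤-reflexive (sym (ι-T l))) (term≤sum (ι ∘ lateAt P q e) v))
                    (m≤n+m _ (ι (early P q e)))
        cases : T (P e) → Dec (T (lateAt P q e (src e))) → Dec (T (lateAt P q e (tgt e))) →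
                1 ≤ ι (early P q e) + # (lateAt P q e)
        cases p (yes l) _       = hit (src e) l
        cases p (no _)  (yes l) = hit (tgt e) l
        cases p (no ¬l) (no ¬r) = ≤-trans (≤-reflexive (sym (ι-T (∧⁺ p (T-not λ d → [ ¬l , ¬r ] (∨⁻ d))))))
                                    (m≤m+n _ _)

    early-after : ∀ P q e v → T (early P q e) → T (incᵇ e v) →
                  q v ≤ after (λ e′ → P e′ ∧ incᵇ e′ v) e
    early-after P q e v E i = ≮⇒≥ λ lt → not-T (proj₂ (∧⁻ {P e} E)) (late lt (inc-end {e} i))
      where
      late : after (λ e′ → P e′ ∧ incᵇ e′ v) e < q v → src e ≡ v ⊎ tgt e ≡ v →
             T (lateAt P q e (src e) ∨ lateAt P q e (tgt e))
      late lt (inj₁ refl) = ∨⁺ˡ (∧⁺ (∧⁺ (early⊆ P q e E) i) (<⇒<ᵇ lt))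
      late lt (inj₂ refl) = ∨⁺ʳ {lateAt P q e (src e)} (∧⁺ (∧⁺ (early⊆ P q e E) i) (<⇒<ᵇ lt))

  -- Robust vertices and the values of edges

  module Climbing {n m : ℕ} (G : OrderedGraph n m) where
    open Hops G public

    other : Fin m → Fin n → Fin n
    other e z = if does (src e ≟ᶠ z) then tgt e else src e

    other-Links : ∀ {e z} → T (incᵇ e z) → Links e z (other e z)
    other-Links {e} {z} i with inc-end {e} {z} i | src e ≟ᶠ z
    ... | _      | yes p = inj₁ (p , refl)
    ... | inj₁ p | no ¬p = contradiction p ¬p
    ... | inj₂ p | no _  = inj₂ (refl , p)

    Links-other : ∀ {e z x} → Links e z x → other e z ≡ x
    Links-other {e} {z} l with src e ≟ᶠ z
    Links-other {e} (inj₁ (_ , q)) | yes _ = q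
    Links-other {e} (inj₂ (_ , q)) | yes p = contradiction (trans p (sym q)) (loopless e)
    Links-other {e} (inj₁ (p , _)) | no ¬p = contradiction p ¬p
    Links-other {e} (inj₂ (p , _)) | no ¬p = p

    -- Averages `g` over the far ends of the edges at `z`: these ends are distinct, so the total is
    -- at most `sum g`, spread over at least `q` edges.
    pick-neighbour : ∀ (P : EdgeSet) z (g : Fin n → ℕ) {q c} →
                     sum g < q * c → q ≤ # (λ e → P e ∧ incᵇ e z) →
                     ∃ λ e → ∃ λ x → T (P e) × Links e z x × g x < c
    pick-neighbour P z g {q} {c} small many
      with sum-< (λ e → ι (P e ∧ incᵇ e z) * g (other e z)) (λ e → ι (P e ∧ incᵇ e z) * c) gap
      where
      open ≤-Reasoning
      gap : sum (λ e → ι (P e ∧ incᵇ e z) * g (other e z)) < sum (λ e → ι (P e ∧ incᵇ e z) * c)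
      gap = begin-strict
        sum (λ e → ι (P e ∧ incᵇ e z) * g (other e z))
          ≤⟨ neighbour-sum P z g _ (λ e x _ l → ≤-reflexive (cong g (Links-other l))) ⟩
        sum g                                    <⟨ small ⟩
        q * c                                    ≤⟨ *-monoˡ-≤ c many ⟩
        # (λ e → P e ∧ incᵇ e z) * c             ≡⟨ *-distribʳ-sum c (λ e → ι (P e ∧ incᵇ e z)) ⟩
        sum (λ e → ι (P e ∧ incᵇ e z) * c)       ∎
    ... | e , lt with P e in eqP | incᵇ e z in eqI
    ...   | true | true = e , other e z , subst T (sym eqP) tt ,
              other-Links (subst T (sym eqI) tt) ,
              subst₂ _<_ (+-identityʳ _) (+-identityʳ c) lt

    memᵇ : List (Fin n) → Fin n → Bool
    memᵇ W x = does (x ∈? W)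

    mem-count : ∀ W → # (memᵇ W) ≤ length W
    mem-count []      = #-none (memᵇ []) λ _ ()
    mem-count (v ∷ W) = ≤-trans
      (#-union {Q = λ x → does (v ≟ᶠ x)} {R = memᵇ W}
         (λ x p → split x (does⇒ (x ∈? (v ∷ W)) p)))
      (+-mono-≤ (equals-once v) (mem-count W))
      where
      split : ∀ x → x ∈ v ∷ W → T (does (v ≟ᶠ x)) ⊎ T (memᵇ W x)
      split x (here p)  = inj₁ (⇒does (v ≟ᶠ x) (sym p))
      split x (there p) = inj₂ (⇒does (x ∈? W) p)

    -- The induction hypothesis. It ranges over all edge sets because the next level applies it to
    -- the edges of one exact value within `away F`.
    Climbs : ℕ → ℕ → ℕ → Set
    Climbs D k r = ∀ Q → D * n < # Q → ∃ λ e → T (Q e) ×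
      Robust Q r k (src e) (suc (toℕ e)) × Robust Q r k (tgt e) (suc (toℕ e))

    #>0 : ∀ {P : EdgeSet} → 0 < # P → ∃ λ e → T (P e)
    #>0 {P} pos with sum-< (λ _ → 0) (ι ∘ P) (≤-<-trans (≤-reflexive (trans (sum-const m 0) (*-zeroʳ m))) pos)
    ... | e , lt = e , ι-pos lt

    -- The `t` later edges lead to distinct neighbours, of which `W` can hide at most `r < t`.
    one-step : ∀ {Q e v t r} → r < t → t ≤ after (λ e′ → Q e′ ∧ incᵇ e′ v) e →
               Robust Q r 1 v (suc (toℕ e))
    one-step {Q} {e} {v} {t} r<t enough W l
      with pick-neighbour (λ e′ → Q e′ ∧ (toℕ e <ᵇ toℕ e′)) v (ι ∘ memᵇ W) {t} {1} few many
      where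
      few : # (memᵇ W) < t * 1
      few = ≤-<-trans (mem-count W) (<-≤-trans (≤-<-trans l r<t) (≤-reflexive (sym (*-identityʳ t))))
      many : t ≤ # (λ e′ → (Q e′ ∧ (toℕ e <ᵇ toℕ e′)) ∧ incᵇ e′ v)
      many = ≤-trans enough
        (#-mono λ e′ p → let (a , b) = ∧⁻ {Q e′ ∧ incᵇ e′ v} p ; (c , d) = ∧⁻ {Q e′} a in
           ∧⁺ (∧⁺ c b) d)
    ... | e′ , x , p , lnk , x∉ = e′ , proj₁ (∧⁻ {Q e′} p) , <ᵇ⇒< _ _ (proj₂ (∧⁻ {Q e′} p)) , x , lnk ,
      (λ x∈ → <-irrefl refl (<-≤-trans x∉ (≤-reflexive (sym (ι-T (⇒does (x ∈? W) x∈)))))) , tt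

    climbs-one : ∀ {t r} → r < t → Climbs t 1 r
    climbs-one {t} {r} r<t Q big = finish (#>0 pos)
      where
      open ≤-Reasoning
      Early : EdgeSet
      Early = early Q (λ _ → t)
      pos : 0 < # Early
      pos = +-cancelʳ-< (n * t) 0 _ (begin-strict
        n * t                               ≡⟨ *-comm n t ⟩
        t * n                               <⟨ big ⟩
        # Q                                 ≤⟨ early-bound Q (λ _ → t) ⟩
        # Early + sum {n} (λ _ → t)         ≡⟨ cong (# Early +_) (sum-const n t) ⟩
        # Early + n * t                     ∎)
      finish : (∃ λ e → T (Early e)) → ∃ λ e → T (Q e) ×
        Robust Q r 1 (src e) (suc (toℕ e)) × Robust Q r 1 (tgt e) (suc (toℕ e))
      finish (e , E) = e , early⊆ Q (λ _ → t) e E ,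
        one-step r<t (early-after Q (λ _ → t) e _ E (src-inc e)) ,
        one-step r<t (early-after Q (λ _ → t) e _ E (tgt-inc e))

    module _ (r k : ℕ) where

      Good? : ∀ Q y e → Dec (Val Q r k y (src e) (suc (toℕ e)) × Val Q r k y (tgt e) (suc (toℕ e)))
      Good? Q y e = Val? Q r k y (src e) (suc (toℕ e)) ×-dec Val? Q r k y (tgt e) (suc (toℕ e))

      goodᵇ : EdgeSet → ℕ → EdgeSet
      goodᵇ Q y e = does (Good? Q y e)

      good-at : ∀ Q y {e v} → T (goodᵇ Q y e) → T (incᵇ e v) → Val Q r k y v (suc (toℕ e))
      good-at Q y {e} g i with does⇒ (Good? Q y e) g | inc-end {e} i
      ... | s , _ | inj₁ refl = s
      ... | _ , t | inj₂ refl = t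

      good-mono : ∀ {Q Q′} y → (∀ e → T (Q e) → T (Q′ e)) → ∀ e → T (goodᵇ Q y e) → T (goodᵇ Q′ y e)
      good-mono {Q} {Q′} y Q⊆ e g = ⇒does (Good? Q′ y e)
        (Val-mono r k y Q⊆ (good-at Q y g (src-inc e)) , Val-mono r k y Q⊆ (good-at Q y g (tgt-inc e)))

    -- A path inside the edges of exact value y ends at a vertex of value y, so an
    -- edge with robust ends among them would have value y + 1.
    few-bad : ∀ {D k r} → Climbs D (suc k) r → ∀ Q y →
              # (λ e → Q e ∧ not (goodᵇ r (suc k) Q y e)) ≤ y * (D * n)
    few-bad {D} {k} {r} climbs Q zero    = #-none (λ e → Q e ∧ not (goodᵇ r (suc k) Q zero e)) λ e p → not-T (proj₂ (∧⁻ {Q e} p)) tt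
    few-bad {D} {k} {r} climbs Q (suc y) = begin
      # (λ e → Q e ∧ not (goodᵇ r (suc k) Q (suc y) e))                 ≤⟨ #-union split ⟩
      # Level + # (λ e → Q e ∧ not (goodᵇ r (suc k) Q y e))             ≤⟨ +-mono-≤ level-small (few-bad {D} climbs Q y) ⟩
      D * n + y * (D * n)                                               ∎
      where
      open ≤-Reasoning
      Level : EdgeSet
      Level e = Q e ∧ goodᵇ r (suc k) Q y e ∧ not (goodᵇ r (suc k) Q (suc y) e)
      split : ∀ e → T (Q e ∧ not (goodᵇ r (suc k) Q (suc y) e)) →
              T (Level e) ⊎ T (Q e ∧ not (goodᵇ r (suc k) Q y e))
      split e p with ∧⁻ {Q e} p | T? (goodᵇ r (suc k) Q y e)
      ... | q , ng | yes g = inj₁ (∧⁺ q (∧⁺ g ng))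
      ... | q , ng | no ¬g = inj₂ (∧⁺ q (T-not ¬g))
      Level⊆ : ∀ e → T (Level e) → T (Q e)
      Level⊆ e = proj₁ ∘ ∧⁻
      level-small : # Level ≤ D * n
      level-small = ≮⇒≥ λ big → absurd (climbs Level big)
        where
        lift : ∀ {v τ} → Robust Level r (suc k) v τ → Val Q r (suc k) (suc y) v τ
        lift rob W l = Hop-end k Level⊆
          (λ e v w p lnk _ → good-at r (suc k) Q y (proj₁ (∧⁻ (proj₂ (∧⁻ {Q e} p)))) (Links-inc (Links-sym lnk)))
          (rob W l)
        absurd : ¬ (∃ λ e → T (Level e) × Robust Level r (suc k) (src e) (suc (toℕ e)) ×
                            Robust Level r (suc k) (tgt e) (suc (toℕ e)))
        absurd (e , p , s , t) = not-T (proj₂ (∧⁻ {goodᵇ r (suc k) Q y e} (proj₂ (∧⁻ {Q e} p))))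
          (⇒does (Good? r (suc k) Q (suc y) e) (lift s , lift t))

    -- Forbidden vertex sets and the edges they spoil

    touchᵇ : List (Fin n) → EdgeSet
    touchᵇ []      e = false
    touchᵇ (v ∷ F) e = incᵇ e v ∨ touchᵇ F e

    touch-∈ : ∀ {F e x} → x ∈ F → T (incᵇ e x) → T (touchᵇ F e)
    touch-∈ (here refl) i = ∨⁺ˡ i
    touch-∈ {v ∷ _} {e} (there x∈) i = ∨⁺ʳ {incᵇ e v} (touch-∈ x∈ i)

    touch-++ : ∀ X {F e} → T (touchᵇ F e) → T (touchᵇ (X ++ F) e)
    touch-++ []      t = t
    touch-++ (v ∷ X) {F} {e} t = ∨⁺ʳ {incᵇ e v} (touch-++ X t)

    degs : EdgeSet → List (Fin n) → ℕ
    degs Q []      = 0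
    degs Q (v ∷ F) = deg Q v + degs Q F

    degs-++ : ∀ Q X F → degs Q (X ++ F) ≡ degs Q X + degs Q F
    degs-++ Q []      F = refl
    degs-++ Q (v ∷ X) F = trans (cong (deg Q v +_) (degs-++ Q X F)) (sym (+-assoc (deg Q v) _ _))

    touch-count : ∀ Q F → # (λ e → Q e ∧ touchᵇ F e) ≤ degs Q F
    touch-count Q []      = #-none (λ e → Q e ∧ false) λ e → proj₂ ∘ ∧⁻ {Q e}
    touch-count Q (v ∷ F) = ≤-trans (#-union split) (+-monoʳ-≤ (deg Q v) (touch-count Q F))
      where
      split : ∀ e → T (Q e ∧ (incᵇ e v ∨ touchᵇ F e)) → T (Q e ∧ incᵇ e v) ⊎ T (Q e ∧ touchᵇ F e)
      split e p with ∧⁻ {Q e} p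
      ... | q , t with ∨⁻ {incᵇ e v} t
      ...   | inj₁ i = inj₁ (∧⁺ q i)
      ...   | inj₂ u = inj₂ (∧⁺ q u)

    module Blocking (Q : EdgeSet) (r k ℓ : ℕ) where

      away : List (Fin n) → EdgeSet
      away F e = Q e ∧ not (touchᵇ F e)

      bad : List (Fin n) → EdgeSet
      bad F e = Q e ∧ (touchᵇ F e ∨ not (goodᵇ r k (away F) ℓ e))

      -- Forbidding more vertices leaves fewer edges, and values can only drop with the edge set.
      bad-mono : ∀ X F e → T (bad F e) → T (bad (X ++ F) e)
      bad-mono X F e b with ∧⁻ {Q e} b
      ... | q , t with ∨⁻ {touchᵇ F e} t
      ...   | inj₁ u = ∧⁺ q (∨⁺ˡ (touch-++ X u))
      ...   | inj₂ ng = ∧⁺ q (∨⁺ʳ {touchᵇ (X ++ F) e}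
                (T-not λ g → not-T ng (good-mono r k ℓ shrink e g)))
        where
        shrink : ∀ e → T (away (X ++ F) e) → T (away F e)
        shrink e a = let (q , nt) = ∧⁻ {Q e} a in ∧⁺ q (T-not λ t → not-T nt (touch-++ X t))

      -- Local maximality of `# (bad F)` minus `2 * degs Q F`: only extensions by at most `g`
      -- vertices are compared, since only such extensions occur later.
      Slack : ℕ → List (Fin n) → Set
      Slack g F = ∀ X → length X ≤ g → # (bad (X ++ F)) ≤ # (bad F) + 2 * degs Q X

      -- Enlarging F while #(bad F) − 2 degs F grows must stop, because this
      -- difference never exceeds the number of edges.
      saturate : ∀ g fuel F s → m ≤ fuel + s → 2 * degs Q F + s ≤ # (bad F) →
                 ∃ λ F* → 2 * degs Q F* ≤ # (bad F*) × Slack g F*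
      saturate g fuel F s enough inv
        with anyList? g (λ X → # (bad F) + 2 * degs Q X <? # (bad (X ++ F)))
      ... | no none = F , ≤-trans (m≤m+n _ s) inv ,
                      λ X l → ≮⇒≥ λ lt → none (X , l , lt)
      ... | yes (X , l , lt) = next fuel enough
        where
        open ≤-Reasoning
        grown : 2 * degs Q (X ++ F) + suc s ≤ # (bad (X ++ F))
        grown = begin
          2 * degs Q (X ++ F) + suc s             ≡⟨ cong (λ d → 2 * d + suc s) (degs-++ Q X F) ⟩
          2 * (degs Q X + degs Q F) + suc s       ≡⟨ rearrange (degs Q X) (degs Q F) s ⟩
          suc (2 * degs Q F + s + 2 * degs Q X)   ≤⟨ s≤s (+-monoˡ-≤ (2 * degs Q X) inv) ⟩
          suc (# (bad F) + 2 * degs Q X)          ≤⟨ lt ⟩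
          # (bad (X ++ F))                        ∎
          where
          rearrange : ∀ a b s → 2 * (a + b) + suc s ≡ suc (2 * b + s + 2 * a)
          rearrange = solve-∀
        next : ∀ fuel → m ≤ fuel + s → ∃ λ F* → 2 * degs Q F* ≤ # (bad F*) × Slack g F*
        next zero enough = contradiction
          (≤-trans (≤-trans (m≤n+m (suc s) (2 * degs Q (X ++ F))) grown) (#≤ (bad (X ++ F))))
          (<⇒≱ (s≤s enough))
        next (suc fuel) enough = saturate g fuel (X ++ F) (suc s)
          (≤-trans enough (≤-reflexive (sym (+-suc fuel s)))) grown

      -- A bad edge either touches `F`, or lies in `away F` and lacks value `ℓ` there; `few-bad`
      -- counts the latter.
      bad-bound : ∀ {D k′} → k ≡ suc k′ → Climbs D k r → ∀ F → # (bad F) ≤ degs Q F + ℓ * (D * n)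
      bad-bound {D} refl climbs F = ≤-trans (#-union split)
        (+-mono-≤ (touch-count Q F) (few-bad {D} climbs (away F) ℓ))
        where
        split : ∀ e → T (bad F e) → T (Q e ∧ touchᵇ F e) ⊎ T (away F e ∧ not (goodᵇ r k (away F) ℓ e))
        split e b with ∧⁻ {Q e} b | T? (touchᵇ F e)
        ... | q , _ | yes t = inj₁ (∧⁺ q t)
        ... | q , c | no ¬t with ∨⁻ {touchᵇ F e} c
        ...   | inj₁ t  = contradiction t ¬t
        ...   | inj₂ ng = inj₂ (∧⁺ (∧⁺ q (T-not ¬t)) ng)

  -- The density increment

  -- An isolated vertex (d = 0) falls into class 0.
  dyadic : ∀ L d → d < 2 ^ suc L → ∃ λ (i : Fin (suc L)) → 2 ^ toℕ i ≤ d ⊔ 1 × d < 2 * 2 ^ toℕ i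
  dyadic zero    d d< = zero , m≤n⊔m d 1 , d<
  dyadic (suc L) d d< with d <? 2 ^ suc L
  ... | no d≮ = Fin.fromℕ (suc L) ,
                subst (λ i → 2 ^ i ≤ d ⊔ 1) (sym (toℕ-fromℕ (suc L))) (≤-trans (≮⇒≥ d≮) (m≤m⊔n d 1)) ,
                subst (λ i → d < 2 * 2 ^ i) (sym (toℕ-fromℕ (suc L))) d<
  ... | yes lt with dyadic L d lt
  ...   | i , lower , upper = inject₁ i ,
          subst (λ i → 2 ^ i ≤ d ⊔ 1) (sym (toℕ-inject₁ i)) lower ,
          subst (λ i → d < 2 * 2 ^ i) (sym (toℕ-inject₁ i)) upper

  module _ {n m : ℕ} (G : OrderedGraph n m) where
    open Climbing G

    pigeonhole : ∀ {L} (Q : EdgeSet) (h : Fin m → Fin (suc L)) →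
                 ∃ λ i → # Q ≤ suc L * # (λ e → Q e ∧ does (h e ≟ᶠ i))
    pigeonhole {L} Q h = conclude (sum-< {suc L} (λ _ → # Q) (λ i → suc (suc L * # (Part i))) enough)
      where
      open ≤-Reasoning
      Part : Fin (suc L) → EdgeSet
      Part i e = Q e ∧ does (h e ≟ᶠ i)
      conclude : (∃ λ i → # Q < suc (suc L * # (Part i))) → ∃ λ i → # Q ≤ suc L * # (Part i)
      conclude (i , s≤s le) = i , le
      cover : # Q ≤ sum (λ i → # (Part i))
      cover = begin
        # Q                                        ≤⟨ sum-mono (λ e → ι≤ λ q → ≤-trans
                                                        (≤-reflexive (sym (ι-T (∧⁺ q (⇒does (h e ≟ᶠ h e) refl)))))
                                                        (term≤sum (λ i → ι (Part i e)) (h e))) ⟩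
        sum (λ e → sum (λ i → ι (Part i e)))       ≡⟨ ∑-comm (λ e i → ι (Part i e)) ⟩
        sum (λ i → # (Part i))                     ∎
      -- Each summand on the right is raised by one to obtain the strict inequality that `sum-<`
      -- takes.
      enough : sum {suc L} (λ _ → # Q) < sum (λ i → suc (suc L * # (Part i)))
      enough = begin-strict
        sum {suc L} (λ _ → # Q)                                   ≡⟨ sum-const (suc L) (# Q) ⟩
        suc L * # Q                                               ≤⟨ *-monoʳ-≤ (suc L) cover ⟩
        suc L * sum (λ i → # (Part i))                            ≡⟨ *-distribˡ-sum (suc L) (λ i → # (Part i)) ⟩
        sum (λ i → suc L * # (Part i))                            <⟨ m<n+m _ {suc L * 1} z<s ⟩
        suc L * 1 + sum (λ i → suc L * # (Part i))                ≡⟨ cong (_+ sum (λ i → suc L * # (Part i))) (sym (sum-const (suc L) 1)) ⟩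
        sum {suc L} (λ _ → 1) + sum (λ i → suc L * # (Part i))    ≡⟨ sym (∑-distrib-+ (λ _ → 1) (λ i → suc L * # (Part i))) ⟩
        sum (λ i → suc (suc L * # (Part i)))                      ∎

    -- Stepping to a neighbour from which the climb continues

    module Landing (Q′ : EdgeSet) (r k ℓ r′ : ℕ) (ℓk≤r : ℓ * k ≤ r) (F* : List (Fin n))
      (slack : Blocking.Slack Q′ r k ℓ (suc r′) F*)
      (q : Fin n → ℕ) (A B M : ℕ)
      (q-src : ∀ e → T (Q′ e) → q (src e) ≡ A) (q-tgt : ∀ e → T (Q′ e) → q (tgt e) ≡ B)
      (deg≤M : ∀ v → deg Q′ v ≤ M)
      (roomA : r′ * A + 4 * (suc r′ * M) < A * B) (roomB : r′ * B + 4 * (suc r′ * M) < A * B)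
      where
      open Blocking Q′ r k ℓ

      -- Two rounds of pruning look two edges ahead: an edge of `early Q‴ q` has a full quota of
      -- later edges of `Q‴` at each end, and each of those has a full quota of later edges of `Q″`
      -- at its own ends.
      Q″ Q‴ : EdgeSet
      Q″ e = Q′ e ∧ not (bad F* e)
      Q‴ = early Q″ q

      Q″⊆ : ∀ e → T (Q″ e) → T (Q′ e)
      Q″⊆ e = proj₁ ∘ ∧⁻

      Q‴⊆ : ∀ e → T (Q‴ e) → T (Q′ e)
      Q‴⊆ e = Q″⊆ e ∘ early⊆ Q″ q e

      degs≤ : ∀ X → degs Q′ X ≤ length X * M
      degs≤ []      = z≤n
      degs≤ (v ∷ X) = +-mono-≤ (deg≤M v) (degs≤ X)

      -- `src` and `tgt` carry no direction of travel, so `z` may lie on either side. If `z` is the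
      -- source of one edge and the target of another, then `A` and `B` coincide, and the two mixed
      -- cases rest on this.
      opposite : ∀ {e z} → T (Q′ e) → T (incᵇ e z) →
                 ∃ λ C → q z * C ≡ A * B × r′ * C + 4 * (suc r′ * M) < A * B ×
                         (∀ e′ x → T (Q′ e′) → Links e′ z x → q x ≡ C)
      opposite {e} p i with inc-end {e} i
      ... | inj₁ refl = B , cong (_* B) (q-src e p) , roomB , λ
        { e′ x p′ (inj₁ (_ , refl)) → q-tgt e′ p′
        ; e′ x p′ (inj₂ (refl , t)) → trans (q-src e′ p′)
            (trans (sym (q-src e p)) (trans (cong q (sym t)) (q-tgt e′ p′))) }
      ... | inj₂ refl = A , trans (cong (_* A) (q-tgt e p)) (*-comm B A) , roomA , λ
        { e′ x p′ (inj₂ (refl , _)) → q-src e′ p′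
        ; e′ x p′ (inj₁ (s , refl)) → trans (q-tgt e′ p′)
            (trans (sym (q-tgt e p)) (trans (cong q (sym s)) (q-src e′ p′))) }

      module _ {e z} (E : T (early Q‴ q e)) (i : T (incᵇ e z)) (W : List (Fin n)) (l : length W ≤ r′) where

        F : List (Fin n)
        F = (z ∷ W) ++ F*

        New : EdgeSet
        New e = Q″ e ∧ bad F e

        -- The new edges are disjoint from `bad F*`, and both sets lie in `bad F`, so `slack` bounds
        -- them. The start `z` is forbidden along with `W` because the path must not return to it,
        -- whence `suc r′`.
        few-new : # New ≤ 2 * (suc r′ * M)
        few-new = +-cancelˡ-≤ (# (bad F*)) _ _ (begin
          # (bad F*) + # New                      ≤⟨ #-disjoint (bad-mono (z ∷ W) F*) (λ e p → proj₂ (∧⁻ {Q″ e} p))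
                                                       (λ e b p → not-T (proj₂ (∧⁻ {Q′ e} (proj₁ (∧⁻ p)))) b) ⟩
          # (bad F)                               ≤⟨ slack (z ∷ W) (s≤s l) ⟩
          # (bad F*) + 2 * degs Q′ (z ∷ W)        ≤⟨ +-monoʳ-≤ (# (bad F*)) (*-monoʳ-≤ 2
                                                       (≤-trans (degs≤ (z ∷ W)) (*-monoˡ-≤ M (s≤s l)))) ⟩
          # (bad F*) + 2 * (suc r′ * M)           ∎)
          where open ≤-Reasoning

        -- A neighbour x of z with quota C is useless only if weight C x ≥ C.
        weight : ℕ → Fin n → ℕ
        weight C x = C * ι (memᵇ W x) + deg New x

        -- The factor 4 is the 2 of `Slack` times the two ends of each new bad edge.
        weight-sum : ∀ C → sum (weight C) ≤ r′ * C + 4 * (suc r′ * M)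
        weight-sum C = begin
          sum (weight C)                                       ≡⟨ ∑-distrib-+ (λ x → C * ι (memᵇ W x)) (deg New) ⟩
          sum (λ x → C * ι (memᵇ W x)) + sum (deg New)         ≡⟨ cong (_+ sum (deg New)) (sym (*-distribˡ-sum C (ι ∘ memᵇ W))) ⟩
          C * # (memᵇ W) + sum (deg New)                       ≤⟨ +-mono-≤ (*-monoʳ-≤ C (≤-trans (mem-count W) l)) (sum-deg New) ⟩
          C * r′ + 2 * # New                                   ≤⟨ +-mono-≤ (≤-reflexive (*-comm C r′)) (*-monoʳ-≤ 2 few-new) ⟩
          r′ * C + 2 * (2 * (suc r′ * M))                      ≡⟨ cong (r′ * C +_) (sym (*-assoc 2 2 (suc r′ * M))) ⟩
          r′ * C + 4 * (suc r′ * M)                            ∎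
          where open ≤-Reasoning

        Onward : Fin m → Fin n → Set
        Onward e₁ x = ∃ λ e₂ → T (Q′ e₂) × T (incᵇ e₂ x) × suc (toℕ e₁) ≤ toℕ e₂ × ¬ T (bad F e₂)

        -- After `e₁` the vertex `x` still has `q x` edges of `Q″`; fewer than that many have become
        -- bad, so one of them survives.
        onward : ∀ {e₁ x} → T (Q‴ e₁) → T (incᵇ e₁ x) → deg New x < q x → Onward e₁ x
        onward {e₁} {x} E₁ i₁ few = conclude (sum-< _ _ (<-≤-trans few (early-after Q″ q e₁ x E₁ i₁)))
          where
          conclude : (∃ λ e₂ → ι (New e₂ ∧ incᵇ e₂ x) < ι ((Q″ e₂ ∧ incᵇ e₂ x) ∧ (toℕ e₁ <ᵇ toℕ e₂))) →
                     Onward e₁ x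
          conclude (e₂ , lt) =
            let (p , later) = ∧⁻ {Q″ e₂ ∧ incᵇ e₂ x} (ι-pos lt)
                (p″ , i₂)   = ∧⁻ {Q″ e₂} p
            in e₂ , Q″⊆ e₂ p″ , i₂ , <ᵇ⇒< _ _ later , λ b →
               <⇒≱ lt (≤-trans (ι≤1 _) (≤-reflexive (sym (ι-T (∧⁺ (∧⁺ p″ b) i₂)))))

        -- The edge `e₂` is never traversed; it only certifies that `x` has value `ℓ` in `away F`
        -- right after it. As the edges of `away F` avoid `F` by themselves, `unroll` starts from
        -- the empty list and the whole tolerance `r` serves the path's own vertices.
        climb-on : ∀ {e₁ x} → Onward e₁ x → Hop Q′ (ℓ * k) Anywhere (z ∷ W) x (suc (toℕ e₁))
        climb-on {e₁} {x} (e₂ , p₂ , i₂ , later , ¬b) = Hop-later (ℓ * k) (≤-trans later (n≤1+n _))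
          (Hop-avoid {A = F} (λ e → proj₁ ∘ ∧⁻) avoids (ℓ * k) (inj₂ ∘ ∈-++⁺ˡ)
            (unroll ℓ [] ℓk≤r (good-at r k (away F) ℓ {e₂} good i₂)))
          where
          good : T (goodᵇ r k (away F) ℓ e₂)
          good with T? (goodᵇ r k (away F) ℓ e₂)
          ... | yes g = g
          ... | no ¬g = contradiction (∧⁺ p₂ (∨⁺ʳ {touchᵇ F e₂} (T-not ¬g))) ¬b
          avoids : ∀ e v w → T (away F e) → Links e v w → w ∉ F
          avoids e v w a lnk w∈ = not-T (proj₂ (∧⁻ {Q′ e} a)) (touch-∈ w∈ (Links-inc (Links-sym lnk)))

        robust-start : Hop Q′ (suc (ℓ * k)) Anywhere W z (suc (toℕ e))
        robust-start = go (opposite (Q‴⊆ e (early⊆ Q‴ q e E)) i)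
          where
          Ahead : EdgeSet
          Ahead e₁ = Q‴ e₁ ∧ (toℕ e <ᵇ toℕ e₁)
          many : q z ≤ # (λ e₁ → Ahead e₁ ∧ incᵇ e₁ z)
          many = ≤-trans (early-after Q‴ q e z E i)
            (#-mono λ e₁ p → let (a , b) = ∧⁻ {Q‴ e₁ ∧ incᵇ e₁ z} p ; (c , d) = ∧⁻ {Q‴ e₁} a in
               ∧⁺ (∧⁺ c b) d)
          go : (∃ λ C → q z * C ≡ A * B × r′ * C + 4 * (suc r′ * M) < A * B ×
                        (∀ e′ x → T (Q′ e′) → Links e′ z x → q x ≡ C)) →
               Hop Q′ (suc (ℓ * k)) Anywhere W z (suc (toℕ e))
          go (C , prod , room , opp) = land (pick-neighbour Ahead z (weight C)
              (≤-<-trans (weight-sum C) (<-≤-trans room (≤-reflexive (sym prod)))) many)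
            where
            land : (∃ λ e₁ → ∃ λ x → T (Ahead e₁) × Links e₁ z x × weight C x < C) →
                   Hop Q′ (suc (ℓ * k)) Anywhere W z (suc (toℕ e))
            land (e₁ , x , a , lnk , light) =
              e₁ , p₁ , <ᵇ⇒< _ _ (proj₂ (∧⁻ {Q‴ e₁} a)) , x , lnk , x∉W ,
              climb-on {e₁} (onward E₁ (Links-inc (Links-sym lnk)) fresh)
              where
              E₁ : T (Q‴ e₁)
              E₁ = proj₁ (∧⁻ a)
              p₁ : T (Q′ e₁)
              p₁ = Q‴⊆ e₁ E₁
              fresh : deg New x < q x
              fresh = ≤-<-trans (m≤n+m (deg New x) (C * ι (memᵇ W x)))
                        (<-≤-trans light (≤-reflexive (sym (opp e₁ x p₁ lnk))))
              x∉W : x ∉ W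
              x∉W x∈ = <⇒≱ light (≤-trans (≤-reflexive (sym (trans (cong (C *_) (ι-T (⇒does (x ∈? W) x∈))) (*-identityʳ C))))
                                     (m≤m+n _ (deg New x)))

  -- Arithmetic of the quotas

  n<κ[1+n/κ] : ∀ a κ .{{_ : NonZero κ}} → a < κ * suc (a / κ)
  n<κ[1+n/κ] a κ = begin-strict
    a                        ≡⟨ m≡m%n+[m/n]*n a κ ⟩
    a % κ + (a / κ) * κ      <⟨ +-monoˡ-< ((a / κ) * κ) (m%n<n a κ) ⟩
    κ + (a / κ) * κ          ≡⟨ cong (κ +_) (*-comm (a / κ) κ) ⟩
    κ + κ * (a / κ)          ≡⟨ sym (*-suc κ (a / κ)) ⟩
    κ * suc (a / κ)          ∎
    where open ≤-Reasoning

  quotient-large : ∀ {a X} κ s .{{_ : NonZero κ}} → 20 * κ * κ * s ≤ X → 2 * X < a → 40 * κ * s ≤ a / κ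
  quotient-large {a} {X} κ s hX ha = s≤s⁻¹ (*-cancelˡ-< κ _ _ (begin-strict
    κ * (40 * κ * s)          ≡⟨ regroup κ s ⟩
    2 * (20 * κ * κ * s)      ≤⟨ *-monoʳ-≤ 2 hX ⟩
    2 * X                     <⟨ ha ⟩
    a                         <⟨ n<κ[1+n/κ] a κ ⟩
    κ * suc (a / κ)           ∎))
    where
    open ≤-Reasoning
    regroup : ∀ κ s → κ * (40 * κ * s) ≡ 2 * (20 * κ * κ * s)
    regroup = solve-∀

  ≤2κ[n/κ] : ∀ a κ .{{_ : NonZero κ}} → 1 ≤ a / κ → a ≤ 2 * κ * (a / κ)
  ≤2κ[n/κ] a κ 1≤ = begin
    a                             ≤⟨ <⇒≤ (n<κ[1+n/κ] a κ) ⟩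
    κ * suc (a / κ)               ≤⟨ *-monoʳ-≤ κ (+-monoˡ-≤ (a / κ) 1≤) ⟩
    κ * (a / κ + a / κ)           ≡⟨ regroup κ (a / κ) ⟩
    2 * κ * (a / κ)               ∎
    where
    open ≤-Reasoning
    regroup : ∀ κ x → κ * (x + x) ≡ 2 * κ * x
    regroup = solve-∀

  -- Put x = a/κ, y = b/κ (rounded down) and s = r + 1. The constant 20, doubled by `2 * X < a`,
  -- makes x and y at least 40κs, while a ≤ 2κx and b ≤ 2κy. After scaling by 40 the left side is at
  -- most 17xy + 16xy, short of 40xy.
  room : ∀ {a b X} κ r .{{_ : NonZero κ}} → 20 * κ * κ * suc r ≤ X → 2 * X < a → 2 * X < b →
         r * (b / κ) + 4 * (suc r * (2 * (a + b))) < (a / κ) * (b / κ)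
  room {a} {b} {X} κ r hX ha hb = *-cancelˡ-< 40 _ _ (begin-strict
    40 * (r * y + 4 * (s * (2 * (a + b))))
      ≡⟨ e₁ (r * y) s a b ⟩
    40 * (r * y) + 320 * s * a + 320 * s * b
      ≤⟨ +-mono-≤ (+-mono-≤ ry (*-monoʳ-≤ (320 * s) (≤2κ[n/κ] a κ x≥1))) (*-monoʳ-≤ (320 * s) (≤2κ[n/κ] b κ y≥1)) ⟩
    40 * κ * s * y + 320 * s * (2 * κ * x) + 320 * s * (2 * κ * y)
      ≡⟨ e₂ κ s x y ⟩
    17 * (40 * κ * s * y) + 16 * (40 * κ * s * x)
      ≤⟨ +-mono-≤ (*-monoʳ-≤ 17 (*-monoˡ-≤ y x-large)) (*-monoʳ-≤ 16 (*-monoˡ-≤ x y-large)) ⟩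
    17 * (x * y) + 16 * (y * x)
      <⟨ e₃ ⟩
    40 * (x * y) ∎)
    where
    open ≤-Reasoning
    s = suc r
    x = a / κ
    y = b / κ
    x-large : 40 * κ * s ≤ x
    x-large = quotient-large κ s hX ha
    y-large : 40 * κ * s ≤ y
    y-large = quotient-large κ s hX hb
    1≤40κs : 1 ≤ 40 * κ * s
    1≤40κs = *-mono-≤ (*-mono-≤ (s≤s {n = 39} z≤n) (>-nonZero⁻¹ κ)) (s≤s {n = r} z≤n)
    x≥1 = ≤-trans 1≤40κs x-large
    y≥1 = ≤-trans 1≤40κs y-large
    e₁ : ∀ c s a b → 40 * (c + 4 * (s * (2 * (a + b)))) ≡ 40 * c + 320 * s * a + 320 * s * b
    e₁ = solve-∀
    e₂ : ∀ κ s x y → 40 * κ * s * y + 320 * s * (2 * κ * x) + 320 * s * (2 * κ * y) ≡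
                     17 * (40 * κ * s * y) + 16 * (40 * κ * s * x)
    e₂ = solve-∀
    ry : 40 * (r * y) ≤ 40 * κ * s * y
    ry = begin
      40 * (r * y)       ≡⟨ sym (*-assoc 40 r y) ⟩
      40 * r * y         ≤⟨ *-monoˡ-≤ y (*-mono-≤ (≤-trans (≤-reflexive (sym (*-identityʳ 40))) (*-monoʳ-≤ 40 (>-nonZero⁻¹ κ))) (n≤1+n r)) ⟩
      40 * κ * s * y     ∎
    e₃ : 17 * (x * y) + 16 * (y * x) < 40 * (x * y)
    e₃ = begin-strict
      17 * (x * y) + 16 * (y * x)   ≡⟨ cong (λ p → 17 * (x * y) + 16 * p) (*-comm y x) ⟩
      17 * (x * y) + 16 * (x * y)   ≡⟨ sym (*-distribʳ-+ (x * y) 17 16) ⟩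
      33 * (x * y)                  <⟨ *-monoˡ-< (x * y) {{>-nonZero (*-mono-≤ x≥1 y≥1)}} (m≤m+n 34 6) ⟩
      40 * (x * y)                  ∎

  -- Assembling one induction step

  module _ {n m : ℕ} (G : OrderedGraph n m) where
    open Climbing G

    module Harvest {D k r : ℕ} (climbs : Climbs D (suc k) r) (ℓ r′ l : ℕ) (ℓk≤r : ℓ * suc k ≤ r)
      (Q Q′ : EdgeSet) (big : 4 * l * (ℓ * D) * n < # Q)
      (Q′⊆ : ∀ e → T (Q′ e) → T (Q e)) (Q≤lQ′ : # Q ≤ l * # Q′)
      (q : Fin n → ℕ) (A B M : ℕ)
      (q-src : ∀ e → T (Q′ e) → q (src e) ≡ A) (q-tgt : ∀ e → T (Q′ e) → q (tgt e) ≡ B)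
      (∑q : 8 * l * sum q ≤ 2 * # Q) (deg≤M : ∀ v → deg Q′ v ≤ M)
      (roomA : r′ * A + 4 * (suc r′ * M) < A * B) (roomB : r′ * B + 4 * (suc r′ * M) < A * B)
      where
      open Blocking Q′ r (suc k) ℓ
      open ≤-Reasoning

      Result : Set
      Result = ∃ λ e → T (Q e) ×
        Robust Q r′ (suc (ℓ * suc k)) (src e) (suc (toℕ e)) ×
        Robust Q r′ (suc (ℓ * suc k)) (tgt e) (suc (toℕ e))

      module _ (F* : List (Fin n)) (sat : 2 * degs Q′ F* ≤ # (bad F*)) (slack : Slack (suc r′) F*) where
        open Landing G Q′ r (suc k) ℓ r′ ℓk≤r F* slack q A B M q-src q-tgt deg≤M roomA roomB

        bad≤ : # (bad F*) ≤ 2 * (ℓ * D * n)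
        bad≤ = +-cancelʳ-≤ (# (bad F*)) _ _ (begin
          # (bad F*) + # (bad F*)                             ≡⟨ e₁ (# (bad F*)) ⟩
          2 * # (bad F*)                                      ≤⟨ *-monoʳ-≤ 2 (bad-bound {D} refl climbs F*) ⟩
          2 * (degs Q′ F* + ℓ * (D * n))                      ≡⟨ e₂ (degs Q′ F*) ℓ D n ⟩
          2 * (ℓ * D * n) + 2 * degs Q′ F*                    ≤⟨ +-monoʳ-≤ (2 * (ℓ * D * n)) sat ⟩
          2 * (ℓ * D * n) + # (bad F*)                        ∎)
          where
          e₁ : ∀ x → x + x ≡ 2 * x
          e₁ = solve-∀
          e₂ : ∀ d ℓ D n → 2 * (d + ℓ * (D * n)) ≡ 2 * (ℓ * D * n) + 2 * d
          e₂ = solve-∀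

        Final : EdgeSet
        Final = early Q‴ q

        Q′≤ : # Q′ ≤ # Final + (2 * sum q + # (bad F*))
        Q′≤ = begin
          # Q′                                              ≤⟨ #-union {R = bad F*} split ⟩
          # Q″ + # (bad F*)                                 ≤⟨ +-monoˡ-≤ (# (bad F*)) (≤-trans (early-bound Q″ q)
                                                                (+-monoˡ-≤ (sum q) (early-bound Q‴ q))) ⟩
          # Final + sum q + sum q + # (bad F*)              ≡⟨ e₁ (# Final) (sum q) (# (bad F*)) ⟩
          # Final + (2 * sum q + # (bad F*))                ∎
          where
          e₁ : ∀ f s b → f + s + s + b ≡ f + (2 * s + b)
          e₁ = solve-∀
          split : ∀ e → T (Q′ e) → T (Q″ e) ⊎ T (bad F* e)
          split e p with T? (bad F* e)
          ... | yes t = inj₂ t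
          ... | no ¬t = inj₁ (∧⁺ p (T-not ¬t))

        -- Out of a budget of `4 * # Q`, the two rounds of quotas take at most half and the bad
        -- edges take less than half, so an edge survives.
        some : 4 * l * 0 < 4 * l * # Final
        some = ≤-<-trans (≤-reflexive (*-zeroʳ (4 * l))) (+-cancelʳ-< (4 * # Q) 0 _ (begin-strict
          4 * # Q                                                   ≤⟨ *-monoʳ-≤ 4 Q≤lQ′ ⟩
          4 * (l * # Q′)                                            ≤⟨ *-monoʳ-≤ 4 (*-monoʳ-≤ l Q′≤) ⟩
          4 * (l * (# Final + (2 * sum q + # (bad F*))))            ≡⟨ e₁ l (# Final) (sum q) (# (bad F*)) ⟩
          4 * l * # Final + (8 * l * sum q + 4 * l * # (bad F*))    <⟨ +-monoʳ-< (4 * l * # Final) (+-mono-≤-< ∑q bad<) ⟩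
          4 * l * # Final + (2 * # Q + 2 * # Q)                     ≡⟨ cong (4 * l * # Final +_) (sym (*-distribʳ-+ (# Q) 2 2)) ⟩
          4 * l * # Final + 4 * # Q                                 ∎))
          where
          e₁ : ∀ l f s b → 4 * (l * (f + (2 * s + b))) ≡ 4 * l * f + (8 * l * s + 4 * l * b)
          e₁ = solve-∀
          e₂ : ∀ l x n → 4 * l * (2 * (x * n)) ≡ 2 * (4 * l * x * n)
          e₂ = solve-∀
          bad< : 4 * l * # (bad F*) < 2 * # Q
          bad< = begin-strict
            4 * l * # (bad F*)             ≤⟨ *-monoʳ-≤ (4 * l) bad≤ ⟩
            4 * l * (2 * (ℓ * D * n))      ≡⟨ e₂ l (ℓ * D) n ⟩
            2 * (4 * l * (ℓ * D) * n)      <⟨ *-monoʳ-< 2 big ⟩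
            2 * # Q                        ∎

        from-final : (∃ λ e → T (Final e)) → Result
        from-final (e , E) = e , Q′⊆ e (Q‴⊆ e (early⊆ Q‴ q e E)) , from (src-inc e) , from (tgt-inc e)
          where
          from : ∀ {z} → T (incᵇ e z) → Robust Q r′ (suc (ℓ * suc k)) z (suc (toℕ e))
          from inc W le = Hop-map (suc (ℓ * suc k)) Q′⊆ (λ _ _ _ _ _ → tt) (robust-start {e} E inc W le)

        from-saturated : Result
        from-saturated = from-final (#>0 (*-cancelˡ-< (4 * l) 0 _ some))

      result : Result
      result = finish (saturate (suc r′) m [] 0 (≤-reflexive (sym (+-identityʳ m))) z≤n)
        where
        finish : (∃ λ F* → 2 * degs Q′ F* ≤ # (bad F*) × Slack (suc r′) F*) → Result
        finish (F* , sat , slack) = from-saturated F* sat slack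

    module Classes {L : ℕ} (κ : ℕ) .{{_ : NonZero κ}} (1<κ : 1 < κ) (Q : EdgeSet) (cl : Fin n → Fin (suc L))
      (lower : ∀ v → 2 ^ toℕ (cl v) ≤ deg Q v ⊔ 1) (upper : ∀ v → deg Q v < 2 * 2 ^ toℕ (cl v))
      where
      open ≤-Reasoning

      -- Quotas proportional to the degree cost only a 2/κ fraction of the edges,
      -- so no regular subgraph is needed.
      quota : Fin n → ℕ
      quota v = 2 ^ toℕ (cl v) / κ

      κ*quota≤deg : ∀ v → κ * quota v ≤ deg Q v
      κ*quota≤deg v = small (deg Q v) (quota v) (begin
        κ * quota v              ≡⟨ *-comm κ (quota v) ⟩
        quota v * κ              ≤⟨ m/n*n≤m (2 ^ toℕ (cl v)) κ ⟩
        2 ^ toℕ (cl v)           ≤⟨ lower v ⟩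
        deg Q v ⊔ 1              ∎)
        where
        small : ∀ d x → κ * x ≤ d ⊔ 1 → κ * x ≤ d
        small (suc d) x       le = ≤-trans le (≤-reflexive (cong suc (⊔-identityʳ d)))
        small zero    zero    le = ≤-reflexive (*-zeroʳ κ)
        -- A vertex of degree 0 is in class 0, whose lower bound is 1 instead of the degree; `1<κ`
        -- rounds its quota down to 0.
        small zero    (suc p) le = contradiction (≤-trans (m≤m*n κ (suc p)) le) (<⇒≱ 1<κ)

      κ*∑quota : κ * sum quota ≤ 2 * # Q
      κ*∑quota = begin
        κ * sum quota               ≡⟨ *-distribˡ-sum κ quota ⟩
        sum (λ v → κ * quota v)     ≤⟨ sum-mono κ*quota≤deg ⟩
        sum (deg Q)                 ≤⟨ sum-deg Q ⟩
        2 * # Q                     ∎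

      module _ (Q′ : EdgeSet) (Q′⊆ : ∀ e → T (Q′ e) → T (Q e)) where

        deg-class : ∀ {v c} → cl v ≡ c → deg Q′ v ≤ 2 * 2 ^ toℕ c
        deg-class {v} refl = ≤-trans
          (#-mono λ e p → let (p′ , inc) = ∧⁻ {Q′ e} p in ∧⁺ (Q′⊆ e p′) inc) (<⇒≤ (upper v))

        class-size : ∀ (end : Fin m → Fin n) c → (∀ e → T (incᵇ e (end e))) →
                     (∀ e → T (Q′ e) → cl (end e) ≡ c) → # Q′ ≤ n * (2 * 2 ^ toℕ c)
        class-size end c inc cl-end = begin
          # Q′                                    ≤⟨ sum-mono (λ e → ι≤ (at-end e)) ⟩
          sum (λ e → sum (λ v → ι (at e v)))      ≡⟨ ∑-comm (λ e v → ι (at e v)) ⟩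
          sum (λ v → # (λ e → at e v))            ≤⟨ sum-mono at-vertex ⟩
          sum {n} (λ _ → 2 * 2 ^ toℕ c)           ≡⟨ sum-const n _ ⟩
          n * (2 * 2 ^ toℕ c)                     ∎
          where
          at : Fin m → Fin n → Bool
          at e v = (Q′ e ∧ incᵇ e v) ∧ does (cl v ≟ᶠ c)
          at-end : ∀ e → T (Q′ e) → 1 ≤ # (at e)
          at-end e p = ≤-trans
            (≤-reflexive (sym (ι-T (∧⁺ (∧⁺ p (inc e)) (⇒does (cl (end e) ≟ᶠ c) (cl-end e p))))))
            (term≤sum (ι ∘ at e) (end e))
          at-vertex : ∀ v → # (λ e → at e v) ≤ 2 * 2 ^ toℕ c
          at-vertex v with cl v ≟ᶠ c
          ... | yes eq = ≤-trans (#-mono λ e → proj₁ ∘ ∧⁻ {Q′ e ∧ incᵇ e v}) (deg-class eq)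
          ... | no _   = ≤-trans (#-none (λ e → (Q′ e ∧ incᵇ e v) ∧ false) λ e → proj₂ ∘ ∧⁻ {Q′ e ∧ incᵇ e v}) z≤n

        module _ {i j : Fin (suc L)} (cl-src : ∀ e → T (Q′ e) → cl (src e) ≡ i)
                 (cl-tgt : ∀ e → T (Q′ e) → cl (tgt e) ≡ j) where

          deg≤ : ∀ v → deg Q′ v ≤ 2 * (2 ^ toℕ i + 2 ^ toℕ j)
          deg≤ v with 0 <? deg Q′ v
          ... | no ¬pos = ≤-trans (≮⇒≥ ¬pos) z≤n
          ... | yes pos with #>0 pos
          ...   | e , p with ∧⁻ {Q′ e} p
          ...     | p′ , inc with inc-end {e} inc
          ...       | inj₁ refl = ≤-trans (deg-class (cl-src e p′)) (*-monoʳ-≤ 2 (m≤m+n (2 ^ toℕ i) (2 ^ toℕ j)))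
          ...       | inj₂ refl = ≤-trans (deg-class (cl-tgt e p′)) (*-monoʳ-≤ 2 (m≤n+m (2 ^ toℕ j) (2 ^ toℕ i)))

    -- At most n vertices of degree at most 2c carry at most 2cn edges. A part holding a 1/l share
    -- of a dense `Q` therefore lies in classes of large degree.
    class-large : ∀ {l X q q′ c} → 4 * l * X * n < q → q ≤ l * q′ → q′ ≤ n * (2 * c) → 2 * X < c
    class-large {l} {X} {q} {q′} {c} big q≤lq′ by-class = *-cancelˡ-< (2 * n * l) _ _ (begin-strict
      2 * n * l * (2 * X)     ≡⟨ e₁ n l X ⟩
      4 * l * X * n           <⟨ big ⟩
      q                       ≤⟨ q≤lq′ ⟩
      l * q′                  ≤⟨ *-monoʳ-≤ l by-class ⟩
      l * (n * (2 * c))       ≡⟨ e₂ n l c ⟩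
      2 * n * l * c           ∎)
      where
      open ≤-Reasoning
      e₁ : ∀ n l x → 2 * n * l * (2 * x) ≡ 4 * l * x * n
      e₁ = solve-∀
      e₂ : ∀ n l x → l * (n * (2 * x)) ≡ 2 * n * l * x
      e₂ = solve-∀

    climbs-step : ∀ {D k r} ℓ r′ L κ .{{_ : NonZero κ}} → n < 2 ^ suc L →
                  8 * (suc L * suc L) ≤ κ → 20 * κ * κ * suc r′ ≤ ℓ * D → ℓ * suc k ≤ r →
                  Climbs D (suc k) r → Climbs (4 * (suc L * suc L) * (ℓ * D)) (suc (ℓ * suc k)) r′
    climbs-step {D} {k} {r} ℓ r′ L κ n< 8L²≤κ 20κ²≤ ℓk≤r climbs Q big =
      dyadic-stage (proj₁ ∘ class) (proj₁ ∘ proj₂ ∘ class) (proj₂ ∘ proj₂ ∘ class)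
      where
      open ≤-Reasoning
      class : ∀ v → ∃ λ (i : Fin (suc L)) → 2 ^ toℕ i ≤ deg Q v ⊔ 1 × deg Q v < 2 * 2 ^ toℕ i
      class v = dyadic L (deg Q v) (≤-<-trans (deg≤n Q v) n<)

      Result : Set
      Result = ∃ λ e → T (Q e) ×
        Robust Q r′ (suc (ℓ * suc k)) (src e) (suc (toℕ e)) ×
        Robust Q r′ (suc (ℓ * suc k)) (tgt e) (suc (toℕ e))

      dyadic-stage : (cl : Fin n → Fin (suc L)) → (∀ v → 2 ^ toℕ (cl v) ≤ deg Q v ⊔ 1) →
                     (∀ v → deg Q v < 2 * 2 ^ toℕ (cl v)) → Result
      dyadic-stage cl lower upper = split (pigeonhole G Q (cl ∘ src))
        where
        open Classes κ (≤-trans (≤-trans (s≤s (s≤s z≤n)) (m≤m*n 8 (suc L * suc L))) 8L²≤κ) Q cl lower upper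

        harvest : ∀ i j (Q′ : EdgeSet) → (∀ e → T (Q′ e) → T (Q e)) →
                  (∀ e → T (Q′ e) → cl (src e) ≡ i) → (∀ e → T (Q′ e) → cl (tgt e) ≡ j) →
                  # Q ≤ suc L * suc L * # Q′ → Result
        harvest i j Q′ Q′⊆ cl-src cl-tgt Q≤ = Harvest.result {D} {k} {r} climbs ℓ r′ (suc L * suc L) ℓk≤r Q Q′
          big Q′⊆ Q≤ quota (2 ^ toℕ i / κ) (2 ^ toℕ j / κ) (2 * (2 ^ toℕ i + 2 ^ toℕ j))
          (λ e p → cong (λ c → 2 ^ toℕ c / κ) (cl-src e p)) (λ e p → cong (λ c → 2 ^ toℕ c / κ) (cl-tgt e p))
          (≤-trans (*-monoˡ-≤ (sum quota) 8L²≤κ) κ*∑quota)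
          (deg≤ Q′ Q′⊆ cl-src cl-tgt)
          -- The same estimate with the roles of the two classes exchanged.
          (subst₂ (λ s t → r′ * (2 ^ toℕ i / κ) + 4 * (suc r′ * (2 * s)) < t)
            (+-comm (2 ^ toℕ j) (2 ^ toℕ i)) (*-comm (2 ^ toℕ j / κ) (2 ^ toℕ i / κ))
            (room {2 ^ toℕ j} {2 ^ toℕ i} κ r′ 20κ²≤ large-tgt large-src))
          (room {2 ^ toℕ i} {2 ^ toℕ j} κ r′ 20κ²≤ large-src large-tgt)
          where
          large-src : 2 * (ℓ * D) < 2 ^ toℕ i
          large-src = class-large {suc L * suc L} {ℓ * D} big Q≤ (class-size Q′ Q′⊆ src i src-inc cl-src)
          large-tgt : 2 * (ℓ * D) < 2 ^ toℕ j
          large-tgt = class-large {suc L * suc L} {ℓ * D} big Q≤ (class-size Q′ Q′⊆ tgt j tgt-inc cl-tgt)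

        split : (∃ λ i → # Q ≤ suc L * # (λ e → Q e ∧ does (cl (src e) ≟ᶠ i))) → Result
        split (i , le) = split′ (pigeonhole G (λ e → Q e ∧ does (cl (src e) ≟ᶠ i)) (cl ∘ tgt))
          where
          split′ : (∃ λ j → # (λ e → Q e ∧ does (cl (src e) ≟ᶠ i)) ≤
                     suc L * # (λ e → (Q e ∧ does (cl (src e) ≟ᶠ i)) ∧ does (cl (tgt e) ≟ᶠ j))) → Result
          split′ (j , le′) = harvest i j _ (λ e → proj₁ ∘ ∧⁻ ∘ proj₁ ∘ ∧⁻)
            (λ e p → does⇒ (cl (src e) ≟ᶠ i) (proj₂ (∧⁻ {Q e} (proj₁ (∧⁻ p)))))
            (λ e p → does⇒ (cl (tgt e) ≟ᶠ j) (proj₂ (∧⁻ {Q e ∧ does (cl (src e) ≟ᶠ i)} p)))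
            (≤-trans (≤-trans le (*-monoʳ-≤ (suc L) le′)) (≤-reflexive (sym (*-assoc (suc L) (suc L) _))))

  -- Iterating the step

  climb : ℕ → ℕ → ℕ
  climb ℓ zero    = 0
  climb ℓ (suc j) = ℓ * suc (climb ℓ j)

  ^≤climb : ∀ ℓ j → ℓ ^ j ≤ suc (climb ℓ j)
  ^≤climb ℓ zero    = ≤-refl
  ^≤climb ℓ (suc j) = m≤n⇒m≤1+n (*-monoʳ-≤ ℓ (^≤climb ℓ j))

  module Tower {n m : ℕ} (G : OrderedGraph n m) (ℓ L κ : ℕ) .{{_ : NonZero κ}} (1≤ℓ : 1 ≤ ℓ)
    (n< : n < 2 ^ suc L) (8L²≤κ : 8 * (suc L * suc L) ≤ κ) where
    open Climbing G
    open ≤-Reasoning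

    c : ℕ
    c = 4 * (suc L * suc L)

    -- Each step multiplies the density by `c * ℓ`. The initial 80 is the 20 of `climbs-step` times
    -- 2 · 2, because the next tolerance involves two roundings of 1 + ℓy up to 2ℓy.
    density : ℕ → ℕ
    density j = (c * ℓ) ^ j * (80 * κ * κ * ℓ)

    1+ℓx≤2ℓx : ∀ x → suc (ℓ * suc x) ≤ 2 * ℓ * suc x
    1+ℓx≤2ℓx x = begin
      1 + ℓ * suc x              ≤⟨ +-monoˡ-≤ (ℓ * suc x) (*-mono-≤ 1≤ℓ (s≤s {n = x} z≤n)) ⟩
      ℓ * suc x + ℓ * suc x      ≡⟨ double ℓ (suc x) ⟩
      2 * ℓ * suc x              ∎
      where
      double : ∀ ℓ y → ℓ * y + ℓ * y ≡ 2 * ℓ * y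
      double = solve-∀

    density-step : ∀ j → c * (ℓ * density j) ≡ density (suc j)
    density-step j = regroup c ℓ ((c * ℓ) ^ j) (80 * κ * κ * ℓ)
      where
      regroup : ∀ c ℓ p t → c * (ℓ * (p * t)) ≡ c * ℓ * p * t
      regroup = solve-∀

    -- The path length grows by a factor of at most 2ℓ per level and the density by cℓ with c ≥ 2,
    -- so the initial margin is never lost.
    density-large : ∀ j → 80 * κ * κ * ℓ * suc (climb ℓ j) ≤ density j
    density-large zero    = ≤-reflexive (trans (*-identityʳ (80 * κ * κ * ℓ)) (sym (*-identityˡ (80 * κ * κ * ℓ))))
    density-large (suc j) = begin
      80 * κ * κ * ℓ * suc (ℓ * suc (climb ℓ j))        ≤⟨ *-monoʳ-≤ (80 * κ * κ * ℓ) (1+ℓx≤2ℓx (climb ℓ j)) ⟩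
      80 * κ * κ * ℓ * (2 * ℓ * suc (climb ℓ j))        ≡⟨ regroup (80 * κ * κ * ℓ) ℓ (suc (climb ℓ j)) ⟩
      2 * (ℓ * (80 * κ * κ * ℓ * suc (climb ℓ j)))      ≤⟨ *-mono-≤ 2≤c (*-monoʳ-≤ ℓ (density-large j)) ⟩
      c * (ℓ * density j)                               ≡⟨ density-step j ⟩
      density (suc j)                                   ∎
      where
      regroup : ∀ t ℓ y → t * (2 * ℓ * y) ≡ 2 * (ℓ * (t * y))
      regroup = solve-∀
      2≤c : 2 ≤ c
      2≤c = *-mono-≤ {2} {4} {1} (s≤s (s≤s z≤n)) (s≤s z≤n)

    -- The lengths are the geometric sums 1 + ℓ + ... + ℓ^j. The tolerance is ℓ times the length,
    -- exactly what the next level spends on chaining ℓ hops.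
    climbs : ∀ j → Climbs (density j) (suc (climb ℓ j)) (ℓ * suc (climb ℓ j))
    climbs zero    = climbs-one {density 0} (begin-strict
      ℓ * 1                       ≡⟨ *-identityʳ ℓ ⟩
      ℓ                           <⟨ m<m*n ℓ 80 {{>-nonZero 1≤ℓ}} (s≤s (s≤s z≤n)) ⟩
      ℓ * 80                      ≤⟨ m≤m*n (ℓ * 80) (κ * κ) {{m*n≢0 κ κ}} ⟩
      ℓ * 80 * (κ * κ)            ≡⟨ regroup ℓ κ ⟩
      1 * (80 * κ * κ * ℓ)        ∎)
      where
      regroup : ∀ ℓ κ → ℓ * 80 * (κ * κ) ≡ 1 * (80 * κ * κ * ℓ)
      regroup = solve-∀
    climbs (suc j) = subst (λ D → Climbs D (suc (climb ℓ (suc j))) (ℓ * suc (climb ℓ (suc j)))) (density-step j)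
      (climbs-step G {density j} ℓ (ℓ * suc (climb ℓ (suc j))) L κ n< 8L²≤κ room-for ≤-refl (climbs j))
      where
      x = climb ℓ j
      regroup : ∀ κ ℓ y → 20 * κ * κ * (2 * ℓ * (2 * ℓ * y)) ≡ ℓ * (80 * κ * κ * ℓ * y)
      regroup = solve-∀
      room-for : 20 * κ * κ * suc (ℓ * suc (ℓ * suc x)) ≤ ℓ * density j
      room-for = begin
        20 * κ * κ * suc (ℓ * suc (ℓ * suc x))      ≤⟨ *-monoʳ-≤ (20 * κ * κ) (1+ℓx≤2ℓx (ℓ * suc x)) ⟩
        20 * κ * κ * (2 * ℓ * suc (ℓ * suc x))      ≤⟨ *-monoʳ-≤ (20 * κ * κ) (*-monoʳ-≤ (2 * ℓ) (1+ℓx≤2ℓx x)) ⟩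
        20 * κ * κ * (2 * ℓ * (2 * ℓ * suc x))      ≡⟨ regroup κ ℓ (suc x) ⟩
        ℓ * (80 * κ * κ * ℓ * suc x)                ≤⟨ *-monoʳ-≤ ℓ (density-large j) ⟩
        ℓ * density j                               ∎

    long-hop : ∀ j → density j * n < m → ∃ λ v → Hop (λ _ → true) (suc (climb ℓ j)) Anywhere [] v 0
    long-hop j big with climbs j (λ _ → true) (<-≤-trans big (≤-reflexive (sym all)))
      where
      all : # {m} (λ _ → true) ≡ m
      all = trans (sum-const m 1) (*-identityʳ m)
    ... | e , _ , rob , _ = src e , Hop-later (suc (climb ℓ j)) z≤n (rob [] z≤n)

  -- Edge orderings as time-stamped graphs

  length-filter-tabulate : ∀ {A : Set} {P : Pred A 0ℓ} (P? : Decidable P) {a} (f : Fin a → A) →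
                           length (filter P? (tabulate f)) ≡ # (λ i → does (P? (f i)))
  length-filter-tabulate P? {zero}  f = refl
  length-filter-tabulate P? {suc a} f with does (P? (f zero))
  ... | true  = cong suc (length-filter-tabulate P? (f ∘ suc))
  ... | false = length-filter-tabulate P? (f ∘ suc)

  length-filter-product : ∀ {A B : Set} {P : Pred (A × B) 0ℓ} (P? : Decidable P) {a b} (f : Fin a → A) (g : Fin b → B) →
                          length (filter P? (cartesianProduct (tabulate f) (tabulate g))) ≡
                          sum (λ i → # (λ j → does (P? (f i , g j))))
  length-filter-product P? {zero}  f g = refl
  length-filter-product P? {suc a} f g = begin
    length (filter P? (map (f zero ,_) (tabulate g) ++ cartesianProduct (tabulate (f ∘ suc)) (tabulate g)))
      ≡⟨ cong length (filter-++ P? (map (f zero ,_) (tabulate g)) _) ⟩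
    length (filter P? (map (f zero ,_) (tabulate g)) ++ filter P? (cartesianProduct (tabulate (f ∘ suc)) (tabulate g)))
      ≡⟨ length-++ (filter P? (map (f zero ,_) (tabulate g))) ⟩
    length (filter P? (map (f zero ,_) (tabulate g))) + length (filter P? (cartesianProduct (tabulate (f ∘ suc)) (tabulate g)))
      ≡⟨ cong₂ _+_ (trans (cong (length ∘ filter P?) (map-tabulate g (f zero ,_))) (length-filter-tabulate P? ((f zero ,_) ∘ g)))
                   (length-filter-product P? (f ∘ suc) g) ⟩
    # (λ j → does (P? (f zero , g j))) + sum (λ i → # (λ j → does (P? (f (suc i) , g j)))) ∎
    where open ≡-Reasoning

  sum-tabulate : ∀ {a} (f : Fin a → ℕ) → sumℓ (tabulate f) ≡ sum f
  sum-tabulate {zero}  f = refl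
  sum-tabulate {suc a} f = cong (f zero +_) (sum-tabulate (f ∘ suc))

  AllPairs-lookup : ∀ {A : Set} {R : A → A → Set} {xs} → AllPairs R xs →
                    ∀ {i j} → toℕ i < toℕ j → R (lookup xs i) (lookup xs j)
  AllPairs-lookup (x∼ ∷ _)   {zero}  {suc j} _       = All.lookup x∼ (∈-lookup j)
  AllPairs-lookup (_ ∷ rest) {suc i} {suc j} (s<s l) = AllPairs-lookup rest l

  module _ {n : ℕ} (G : Graph n) where
    open Graph G using (Adj; adj?) renaming (sym to adj-sym; irrefl to adj-irrefl)

    degreeSum : ℕ
    degreeSum = sumℓ (map (degree G) (allFin n))

    Ascending : Pred (Fin n × Fin n) 0ℓ
    Ascending (v , w) = v Fin.< w × Adj v w

    ascending? : Decidable Ascending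
    ascending? (v , w) = v Finₚ.<? w ×-dec adj? v w

    ends : Edge G → Fin n × Fin n
    ends e = Edge.lo e , Edge.hi e

    ends-injective : ∀ {e e′ : Edge G} → ends e ≡ ends e′ → e ≡ e′
    ends-injective refl = refl

    toEdges : ∀ xs → All Ascending xs → List (Edge G)
    toEdges []             []                = []
    toEdges ((v , w) ∷ xs) ((v<w , vw) ∷ ps) = mkEdge v w v<w vw ∷ toEdges xs ps

    length-toEdges : ∀ xs ps → length (toEdges xs ps) ≡ length xs
    length-toEdges []       []       = refl
    length-toEdges (x ∷ xs) (p ∷ ps) = cong suc (length-toEdges xs ps)

    unique-toEdges : ∀ xs ps → Unique xs → Unique (toEdges xs ps)
    unique-toEdges []       []       []       = []
    unique-toEdges (x ∷ xs) (p ∷ ps) (u ∷ us) = apart x p xs ps u ∷ unique-toEdges xs ps us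
      where
      apart : ∀ x (p : Ascending x) xs ps → All (λ y → ¬ x ≡ y) xs → All (λ e → ¬ mkEdge (proj₁ x) (proj₂ x) (proj₁ p) (proj₂ p) ≡ e) (toEdges xs ps)
      apart x p []       []       []       = []
      apart x p (y ∷ xs) (q ∷ ps) (u ∷ us) = (λ eq → u (cong ends eq)) ∷ apart x p xs ps us

    pairs : List (Fin n × Fin n)
    pairs = filter ascending? (cartesianProduct (allFin n) (allFin n))

    pairs-ascending : All Ascending pairs
    pairs-ascending = all-filter ascending? (cartesianProduct (allFin n) (allFin n))

    edges : List (Edge G)
    edges = toEdges pairs pairs-ascending

    edges-unique : Unique edges
    edges-unique = unique-toEdges pairs pairs-ascending (filter⁺ ascending? (cartesianProduct⁺ (allFin⁺ n) (allFin⁺ n)))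

    degreeSum≤ : degreeSum ≤ 2 * length edges
    degreeSum≤ = begin
      degreeSum                                                      ≡⟨ cong sumℓ (map-tabulate id (degree G)) ⟩
      sumℓ (tabulate (degree G))                                 ≡⟨ sum-tabulate (degree G) ⟩
      sum (degree G)                                                 ≡⟨ sum-cong-≗ (λ v → length-filter-tabulate (adj? v) id) ⟩
      sum (λ v → # (λ w → does (adj? v w)))                          ≤⟨ sum-mono (λ v → #-union {Q = asc v} {R = λ w → asc w v} (oriented v)) ⟩
      sum (λ v → # (asc v) + # (λ w → asc w v))                      ≡⟨ ∑-distrib-+ (λ v → # (asc v)) (λ v → # (λ w → asc w v)) ⟩
      sum (λ v → # (asc v)) + sum (λ v → # (λ w → asc w v))          ≡⟨ cong (sum (λ v → # (asc v)) +_) (∑-comm (λ v w → ι (asc w v))) ⟩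
      sum (λ v → # (asc v)) + sum (λ w → # (asc w))                  ≡⟨ cong (λ s → s + s) (sym (length-filter-product ascending? id id)) ⟩
      length pairs + length pairs                                    ≡⟨ cong (λ l → l + l) (sym (length-toEdges pairs pairs-ascending)) ⟩
      length edges + length edges                                    ≡⟨ cong (length edges +_) (sym (+-identityʳ (length edges))) ⟩
      2 * length edges                                               ∎
      where
      open ≤-Reasoning
      asc : Fin n → Fin n → Bool
      asc v w = does (ascending? (v , w))
      oriented : ∀ v w → T (does (adj? v w)) → T (asc v w) ⊎ T (asc w v)
      oriented v w p with Finₚ.<-cmp v w
      ... | tri< v<w _ _ = inj₁ (⇒does (ascending? (v , w)) (v<w , does⇒ (adj? v w) p))
      ... | tri≈ _ refl _ = contradiction (does⇒ (adj? v v) p) adj-irrefl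
      ... | tri> _ _ w<v = inj₂ (⇒does (ascending? (w , v)) (w<v , adj-sym (does⇒ (adj? v w) p)))

    degreeSum-upper : degreeSum + n ≤ n * n
    degreeSum-upper = begin
      degreeSum + n                                  ≡⟨ cong₂ _+_ (trans (cong sumℓ (map-tabulate id (degree G))) (sum-tabulate (degree G)))
                                                          (sym (trans (sum-const n 1) (*-identityʳ n))) ⟩
      sum (degree G) + sum {n} (λ _ → 1)             ≡⟨ sym (∑-distrib-+ (degree G) (λ _ → 1)) ⟩
      sum (λ v → degree G v + 1)                     ≤⟨ sum-mono few ⟩
      sum {n} (λ _ → n)                              ≡⟨ sum-const n n ⟩
      n * n                                          ∎
      where
      open ≤-Reasoning
      few : ∀ v → degree G v + 1 ≤ n
      few v = begin
        degree G v + 1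
          ≤⟨ +-mono-≤ (≤-reflexive (length-filter-tabulate (adj? v) id))
               (≤-trans (≤-reflexive (sym (ι-T (⇒does (v ≟ᶠ v) refl)))) (term≤sum (λ w → ι (does (v ≟ᶠ w))) v)) ⟩
        # (λ w → does (adj? v w)) + # (λ w → does (v ≟ᶠ w))
          ≤⟨ #-disjoint {P = λ w → does (adj? v w)} {Q = λ w → does (v ≟ᶠ w)} {R = λ _ → true} _ _ apart ⟩
        # {n} (λ _ → true)                           ≡⟨ trans (sum-const n 1) (*-identityʳ n) ⟩
        n                                            ∎
        where
        apart : ∀ w → T (does (adj? v w)) → ¬ T (does (v ≟ᶠ w))
        apart w p q with does⇒ (v ≟ᶠ w) q
        ... | refl = adj-irrefl (does⇒ (adj? v v) p)

    lo≢hi : ∀ (e : Edge G) → ¬ Edge.lo e ≡ Edge.hi e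
    lo≢hi (mkEdge v w v<w _) eq = Finₚ.<-irrefl eq (recompute (v Finₚ.<? w) v<w)

    module _ (O : EdgeOrdering G) where
      open EdgeOrdering O
      open IsTotalOrder isTotalOrder using (total; antisym)
        renaming (trans to ≤ᴱ-trans; reflexive to ≤ᴱ-reflexive)

      _≟ᴱ_ : (e e′ : Edge G) → Dec (e ≡ e′)
      e ≟ᴱ e′ with Edge.lo e ≟ᶠ Edge.lo e′ | Edge.hi e ≟ᶠ Edge.hi e′
      ... | yes p | yes q = yes (ends-injective (cong₂ _,_ p q))
      ... | no ¬p | _     = no (¬p ∘ cong Edge.lo)
      ... | yes _ | no ¬q = no (¬q ∘ cong Edge.hi)

      -- Sorting requires a decision procedure, which the ordering does not supply; totality,
      -- antisymmetry and decidable equality of edges yield one.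
      _≤ᴱ?_ : (e e′ : Edge G) → Dec (e ≤ᴱ e′)
      e ≤ᴱ? e′ with total e e′ | e ≟ᴱ e′
      ... | inj₁ le | _       = yes le
      ... | inj₂ _  | yes eq  = yes (≤ᴱ-reflexive eq)
      ... | inj₂ ge | no neq  = no λ le → neq (antisym le ge)

      edgeOrder : DecTotalOrder 0ℓ 0ℓ 0ℓ
      edgeOrder = record
        { Carrier = Edge G ; _≈_ = _≡_ ; _≤_ = _≤ᴱ_
        ; isDecTotalOrder = record { isTotalOrder = isTotalOrder ; _≟_ = _≟ᴱ_ ; _≤?_ = _≤ᴱ?_ } }

      open Sort edgeOrder using (sort; sort-↭; sort-↗)

      sorted : List (Edge G)
      sorted = sort edges

      count : ℕ
      count = length sorted

      at : Fin count → Edge G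
      at = lookup sorted

      count≡ : count ≡ length edges
      count≡ = ↭-length (sort-↭ edges)

      at-mono : ∀ {i j} → toℕ i ≤ toℕ j → at i ≤ᴱ at j
      at-mono {i} {j} i≤j with m≤n⇒m<n∨m≡n i≤j
      ... | inj₁ i<j = AllPairs-lookup (Linked⇒AllPairs ≤ᴱ-trans (sort-↗ edges)) i<j
      ... | inj₂ i≡j = ≤ᴱ-reflexive (cong at (toℕ-injective i≡j))

      sorted-unique : Unique sorted
      sorted-unique = SetoidPerm.Unique-resp-↭ (setoid (Edge G)) (↭⇒↭ₛ (↭-sym (sort-↭ edges))) edges-unique

      at-injective : ∀ {i j} → at i ≡ at j → i ≡ j
      at-injective {i} {j} eq with <-cmp (toℕ i) (toℕ j)
      ... | tri< i<j _ _ = contradiction eq (AllPairs-lookup sorted-unique i<j)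
      ... | tri≈ _ i≡j _ = toℕ-injective i≡j
      ... | tri> _ _ j<i = contradiction (sym eq) (AllPairs-lookup sorted-unique j<i)

      ordered : OrderedGraph n count
      ordered = record
        { src = Edge.lo ∘ at
        ; tgt = Edge.hi ∘ at
        ; loopless = lo≢hi ∘ at
        ; simple = λ l l′ → at-injective (joined l l′)
        }
        where
        crossed : ∀ (e e′ : Edge G) → Edge.lo e ≡ Edge.hi e′ → ¬ Edge.hi e ≡ Edge.lo e′
        crossed (mkEdge v w v<w _) (mkEdge _ _ w<v _) refl refl =
          Finₚ.<-asym (recompute (v Finₚ.<? w) v<w) (recompute (w Finₚ.<? v) w<v)
        joined : ∀ {e e′ : Edge G} {v w} → Joins G e v w → Joins G e′ v w → e ≡ e′
        joined           (inj₁ (p , q)) (inj₁ (p′ , q′)) = ends-injective (cong₂ _,_ (trans p (sym p′)) (trans q (sym q′)))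
        joined           (inj₂ (p , q)) (inj₂ (p′ , q′)) = ends-injective (cong₂ _,_ (trans p (sym p′)) (trans q (sym q′)))
        joined {e} {e′}  (inj₁ (p , q)) (inj₂ (p′ , q′)) = contradiction (trans q (sym p′)) (crossed e e′ (trans p (sym q′)))
        joined {e} {e′}  (inj₂ (p , q)) (inj₁ (p′ , q′)) = contradiction (trans q (sym p′)) (crossed e e′ (trans p (sym q′)))

      open Climbing ordered

      Monotone-from : ℕ → List (Fin n) → Fin n → ℕ → Set
      Monotone-from k W v τ = ∃ λ (vertex : Fin (suc k) → Fin n) → ∃ λ (index : Fin k → Fin count) →
        vertex zero ≡ v ×
        (∀ i → Joins G (at (index i)) (vertex (inject₁ i)) (vertex (suc i))) ×
        (∀ i → τ ≤ toℕ (index i)) ×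
        (∀ i j → toℕ i ≤ toℕ j → toℕ (index i) ≤ toℕ (index j)) ×
        (∀ i → vertex (suc i) ∉ W) ×
        (∀ i j → vertex i ≡ vertex j → i ≡ j)

      monotone-from : ∀ {Q} k {W v τ} → Hop Q k Anywhere W v τ → Monotone-from k W v τ
      monotone-from zero {v = v} _ = (λ _ → v) , (λ ()) , refl , (λ ()) , (λ ()) , (λ ()) , (λ ()) ,
        λ { zero zero _ → refl }
      monotone-from {Q} (suc k) {W} {v} {τ} (e , _ , τ≤e , w , lnk , w∉ , rest) with monotone-from {Q} k rest
      ... | vertex , index , refl , joins , late , mono , fresh , distinct =
        vertex′ , index′ , refl , joins′ , late′ , mono′ , fresh′ , distinct′
        where
        vertex′ : Fin (suc (suc k)) → Fin n
        vertex′ zero    = v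
        vertex′ (suc i) = vertex i
        index′ : Fin (suc k) → Fin count
        index′ zero    = e
        index′ (suc i) = index i
        joins′ : ∀ i → Joins G (at (index′ i)) (vertex′ (inject₁ i)) (vertex′ (suc i))
        joins′ zero    = lnk
        joins′ (suc i) = joins i
        late′ : ∀ i → τ ≤ toℕ (index′ i)
        late′ zero    = τ≤e
        late′ (suc i) = ≤-trans τ≤e (≤-trans (n≤1+n _) (late i))
        mono′ : ∀ i j → toℕ i ≤ toℕ j → toℕ (index′ i) ≤ toℕ (index′ j)
        mono′ zero    zero    _       = ≤-refl
        mono′ zero    (suc j) _       = ≤-trans (n≤1+n _) (late j)
        mono′ (suc i) (suc j) (s≤s l) = mono i j l
        fresh′ : ∀ i → vertex′ (suc i) ∉ W
        fresh′ zero    = w∉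
        fresh′ (suc i) = fresh i ∘ there
        v∉ : ∀ i → ¬ v ≡ vertex i
        v∉ zero    eq = loopless e (link-loop lnk)
          where
          link-loop : Links e v (vertex zero) → src e ≡ tgt e
          link-loop (inj₁ (p , q)) = trans p (trans eq (sym q))
          link-loop (inj₂ (p , q)) = trans p (trans (sym eq) (sym q))
        v∉ (suc i) eq = fresh i (here (sym eq))
        distinct′ : ∀ i j → vertex′ i ≡ vertex′ j → i ≡ j
        distinct′ zero    zero    _  = refl
        distinct′ zero    (suc j) eq = contradiction eq (v∉ j)
        distinct′ (suc i) zero    eq = contradiction (sym eq) (v∉ i)
        distinct′ (suc i) (suc j) eq = cong suc (distinct i j eq)

      hop⇒path : ∀ {Q k W v τ} → Hop Q k Anywhere W v τ → ∃[ P ] IsMonotone G O {k} P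
      hop⇒path {Q} {k} h with monotone-from {Q} k h
      ... | vertex , index , _ , joins , _ , mono , _ , distinct =
        record { vertex = vertex ; distinct = λ {i} {j} → distinct i j ; edge = at ∘ index ; joins = joins } ,
        inj₁ (λ {i} {j} l → at-mono (mono i j l))

    module _ {f : ℕ} (alt : IsAltitude G f) where

      altitude-large : ∀ ℓ L j → 1 ≤ ℓ → n < 2 ^ suc L →
        2 * ((4 * (suc L * suc L) * ℓ) ^ j * (80 * (8 * (suc L * suc L)) * (8 * (suc L * suc L)) * ℓ) * n) < degreeSum →
        ℓ ^ j ≤ f
      altitude-large ℓ L j 1≤ℓ n< dense = ≤-trans (^≤climb ℓ j) (proj₂ alt _ λ O →
        let open Tower (ordered O) ℓ L (8 * (suc L * suc L)) 1≤ℓ n< ≤-refl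
        -- The value 8(L + 1)² is the least κ that the quota condition admits, hence `≤-refl`.
        in hop⇒path O (proj₂ (long-hop j (<-≤-trans
             (*-cancelˡ-< 2 _ _ (<-≤-trans dense degreeSum≤)) (≤-reflexive (sym (count≡ O)))))))

      -- Covers the ranges in which climbing gives nothing: a degree below the loss factor, and ℓ =
      -- 0.
      altitude-positive : 0 < degreeSum → 1 ≤ f
      altitude-positive pos = proj₂ alt 1 single
        where
        nonempty : 0 < length edges
        nonempty = *-cancelˡ-< 2 _ _ (<-≤-trans pos degreeSum≤)
        single : Unavoidable G 1
        single O = hop⇒path O {λ _ → true} {1} {[]} {Edge.lo (at O e)} {0}
          (e , tt , z≤n , Edge.hi (at O e) , inj₁ (refl , refl) , (λ ()) , tt)
          where
          e : Fin (count O)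
          e = Fin.fromℕ< (<-≤-trans nonempty (≤-reflexive (sym (count≡ O))))

  -- Balancing the parameters

  *-^ : ∀ x y b → (x * y) ^ b ≡ x ^ b * y ^ b
  *-^ x y zero    = refl
  *-^ x y (suc b) = begin
    x * y * (x * y) ^ b         ≡⟨ cong (x * y *_) (*-^ x y b) ⟩
    x * y * (x ^ b * y ^ b)     ≡⟨ swap x y (x ^ b) (y ^ b) ⟩
    x * x ^ b * (y * y ^ b)     ∎
    where
    open ≡-Reasoning
    swap : ∀ x y p q → x * y * (p * q) ≡ x * p * (y * q)
    swap = solve-∀

  ^-cancelˡ-≤ : ∀ {x y} b .{{_ : NonZero b}} → x ^ b ≤ y ^ b → x ≤ y
  ^-cancelˡ-≤ b le = ≮⇒≥ λ lt → <⇒≱ (^-monoˡ-< b lt) le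

  2^-cancel-≤ : ∀ {x y} → 2 ^ x ≤ 2 ^ y → x ≤ y
  2^-cancel-≤ le = ≮⇒≥ λ lt → <⇒≱ (^-monoʳ-< 2 (s≤s (s≤s z≤n)) lt) le

  last-true : ∀ {P : ℕ → Set} → (∀ i → Dec (P i)) → P 0 → ∀ N → ¬ P N → ∃ λ i → P i × ¬ P (suc i)
  last-true P? p zero    ¬p = contradiction p ¬p
  last-true P? p (suc N) ¬p with P? N
  ... | yes q = N , q , ¬p
  ... | no ¬q = last-true P? p N ¬q

  -- Real exponents are fractions with common denominator b: with d = s / n the
  -- hypotheses read log d ≤ U/b, log M ≤ 1 + W/b and (U/b) (W/b) ≤ (S/b)².
  module Balance (n s f M : ℕ) .{{_ : NonZero n}} (1≤s : 1 ≤ s) (1≤f : 1 ≤ f)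
    (climbs : ∀ ℓ j → 1 ≤ ℓ →
      2 * ((4 * (M * M) * ℓ) ^ j * (80 * (8 * (M * M)) * (8 * (M * M)) * ℓ) * n) < s → ℓ ^ j ≤ f)
    (1≤M : 1 ≤ M)
    (b U W S : ℕ) .{{_ : NonZero b}}
    (s≼U : s ^ b ≤ 2 ^ U * n ^ b) (M≼ : M ^ b ≤ 2 ^ (b + W)) (b≤2W : b ≤ 2 * W) (UW≤S² : U * W ≤ S * S)
    where
    open ≤-Reasoning

    infix 4 _≼_
    record _≼_ (x E : ℕ) : Set where
      constructor log
      field bound : x ^ b ≤ 2 ^ E
    open _≼_

    ≼-* : ∀ {x y E E′} → x ≼ E → y ≼ E′ → x * y ≼ E + E′
    ≼-* {x} {y} {E} {E′} (log p) (log q) = log (begin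
      (x * y) ^ b       ≡⟨ *-^ x y b ⟩
      x ^ b * y ^ b     ≤⟨ *-mono-≤ p q ⟩
      2 ^ E * 2 ^ E′    ≡⟨ sym (^-distribˡ-+-* 2 E E′) ⟩
      2 ^ (E + E′)      ∎)

    ≼-^ : ∀ {x E} k → x ≼ E → x ^ k ≼ k * E
    ≼-^ zero    p = log (≤-reflexive (^-zeroˡ b))
    ≼-^ {x} {E} (suc k) p = ≼-* {x} {x ^ k} {E} p (≼-^ {x} {E} k p)

    2≼b : 2 ≼ b
    2≼b = log ≤-refl

    1≤W : 1 ≤ W
    1≤W = *-cancelˡ-< 2 0 W (<-≤-trans (>-nonZero⁻¹ b) b≤2W)

    instance
      W≢0 : NonZero W
      W≢0 = >-nonZero 1≤W

    -- Here UW ≤ S² ≤ SW gives U ≤ S, so the loss factor already exceeds d, and f ≥ 1 suffices.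
    small-S : S < W → s ^ b ≤ f ^ b * 2 ^ (67 * S) * n ^ b
    small-S S<W = begin
      s ^ b                               ≤⟨ s≼U ⟩
      2 ^ U * n ^ b                       ≤⟨ *-monoˡ-≤ (n ^ b) (begin
        2 ^ U                               ≤⟨ ^-monoʳ-≤ 2 (≤-trans U≤S (m≤n*m S 67)) ⟩
        2 ^ (67 * S)                        ≡⟨ sym (*-identityˡ _) ⟩
        1 * 2 ^ (67 * S)                    ≤⟨ *-monoˡ-≤ (2 ^ (67 * S)) (≤-trans (≤-reflexive (sym (^-zeroˡ b))) (^-monoˡ-≤ b 1≤f)) ⟩
        f ^ b * 2 ^ (67 * S)                ∎) ⟩
      f ^ b * 2 ^ (67 * S) * n ^ b        ∎
      where
      U≤S : U ≤ S
      U≤S = *-cancelʳ-≤ U S W (≤-trans UW≤S² (*-monoʳ-≤ S (<⇒≤ S<W)))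

    -- k ≈ U / S, so that (log d) / k ≤ S / b, while k W ≤ S + W.
    module _ (W≤S : W ≤ S) where
      instance
        S≢0 : NonZero S
        S≢0 = >-nonZero (≤-trans 1≤W W≤S)

      k : ℕ
      k = suc (U / S)

      U≤Sk : U ≤ S * k
      U≤Sk = <⇒≤ (n<κ[1+n/κ] U S)

      kW≤ : k * W ≤ S + W
      kW≤ = ≤-trans (≤-reflexive (+-comm W (U / S * W))) (+-monoˡ-≤ W (*-cancelʳ-≤ (U / S * W) S S (begin
        U / S * W * S     ≡⟨ *-assoc (U / S) W S ⟩
        U / S * (W * S)   ≡⟨ cong (U / S *_) (*-comm W S) ⟩
        U / S * (S * W)   ≡⟨ sym (*-assoc (U / S) S W) ⟩
        U / S * S * W     ≤⟨ *-monoˡ-≤ W (m/n*n≤m U S) ⟩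
        U * W             ≤⟨ UW≤S² ⟩
        S * S             ∎)))

      -- `A` gathers the density requirement apart from its powers of ℓ and the factor n; 10240 = 2
      -- · 80 · 8 · 8.
      l A : ℕ
      l = M * M
      A = 10240 * l * l * (4 * l) ^ k

      dense⇒ : ∀ ℓ → A * ℓ ^ suc k * n ≡ 2 * ((4 * l * ℓ) ^ k * (80 * (8 * l) * (8 * l) * ℓ) * n)
      dense⇒ ℓ = trans (regroup l ((4 * l) ^ k) ℓ (ℓ ^ k) n)
        (cong (λ p → 2 * (p * (80 * (8 * l) * (8 * l) * ℓ) * n)) (sym (*-^ (4 * l) ℓ k)))
        where
        regroup : ∀ l p ℓ q n → 10240 * l * l * p * (ℓ * q) * n ≡ 2 * (p * q * (80 * (8 * l) * (8 * l) * ℓ) * n)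
        regroup = solve-∀

      1≤A : 1 ≤ A
      1≤A = *-mono-≤ (*-mono-≤ (*-mono-≤ (s≤s {n = 10239} z≤n) 1≤l) 1≤l) (m^n>0 (4 * l) {{m*n≢0 4 l {{_}} {{>-nonZero 1≤l}}}} k)
        where
        1≤l : 1 ≤ l
        1≤l = *-mono-≤ 1≤M 1≤M

      1≤n : 1 ≤ n
      1≤n = >-nonZero⁻¹ n

      Reached : ℕ → Set
      Reached ℓ = s ≤ A * 2 ^ suc k * ℓ * f * n

      -- Take ℓ where A ℓ^(k+1) n is about to pass s. Below the crossing ℓ^k ≤ f; replacing ℓ + 1 by
      -- 2ℓ costs 2^(k+1); and the one factor ℓ not covered by f is at most d^(1/(k+1)) ≤ 2^(S/b).
      choose : ∃ λ ℓ → ℓ ≼ S × Reached ℓ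
      choose = pick (last-true {λ ℓ → A * ℓ ^ suc k * n < s} (λ ℓ → A * ℓ ^ suc k * n <? s)
        (≤-trans (≤-reflexive (cong suc (cong (_* n) (*-zeroʳ A)))) 1≤s) s (≤⇒≯ over))
        where
        over : s ≤ A * s ^ suc k * n
        over = begin
          s                            ≡⟨ sym (trans (*-identityʳ (1 * s)) (*-identityˡ s)) ⟩
          1 * s * 1                    ≤⟨ *-mono-≤ (*-mono-≤ 1≤A (begin
            s                            ≡⟨ sym (*-identityʳ s) ⟩
            s * 1                        ≤⟨ *-monoʳ-≤ s (m^n>0 s {{>-nonZero 1≤s}} k) ⟩
            s * s ^ k                    ∎)) 1≤n ⟩
          A * s ^ suc k * n            ∎

        pick : (∃ λ ℓ → A * ℓ ^ suc k * n < s × ¬ A * suc ℓ ^ suc k * n < s) → ∃ λ ℓ → ℓ ≼ S × Reached ℓ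
        -- When not even ℓ = 1 is dense enough, s ≤ A n; the witness becomes 1 and `1≤f` replaces
        -- the bound from climbing.
        pick (zero , _ , ¬P) = 1 , log (≤-trans (≤-reflexive (^-zeroˡ b)) (m^n>0 2 S)) , (begin
          s                                   ≤⟨ ≮⇒≥ ¬P ⟩
          A * 1 ^ suc k * n                   ≡⟨ cong (λ p → A * p * n) (^-zeroˡ (suc k)) ⟩
          A * 1 * n                           ≤⟨ *-monoˡ-≤ n (*-monoʳ-≤ A (*-mono-≤ (*-mono-≤ (m^n>0 2 (suc k)) (≤-refl {1})) 1≤f)) ⟩
          A * (2 ^ suc k * 1 * f) * n         ≡⟨ regroup A (2 ^ suc k) f n ⟩
          A * 2 ^ suc k * 1 * f * n           ∎)
          where
          regroup : ∀ a p f n → a * (p * 1 * f) * n ≡ a * p * 1 * f * n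
          regroup = solve-∀
        pick (ℓ@(suc ℓ′) , P , ¬P) = ℓ , log (^-cancelˡ-≤ (suc k) powers) , (begin
          s                                   ≤⟨ ≮⇒≥ ¬P ⟩
          A * suc ℓ ^ suc k * n               ≤⟨ *-monoˡ-≤ n (*-monoʳ-≤ A (^-monoˡ-≤ (suc k) 1+ℓ≤2ℓ)) ⟩
          A * (2 * ℓ) ^ suc k * n             ≡⟨ cong (λ p → A * p * n) (*-^ 2 ℓ (suc k)) ⟩
          A * (2 ^ suc k * (ℓ * ℓ ^ k)) * n   ≤⟨ *-monoˡ-≤ n (*-monoʳ-≤ A (*-monoʳ-≤ (2 ^ suc k) (*-monoʳ-≤ ℓ ℓ^k≤f))) ⟩
          A * (2 ^ suc k * (ℓ * f)) * n       ≡⟨ regroup A (2 ^ suc k) ℓ f n ⟩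
          A * 2 ^ suc k * ℓ * f * n           ∎)
          where
          regroup : ∀ a p ℓ f n → a * (p * (ℓ * f)) * n ≡ a * p * ℓ * f * n
          regroup = solve-∀
          1+ℓ≤2ℓ : suc ℓ ≤ 2 * ℓ
          1+ℓ≤2ℓ = ≤-trans (+-monoˡ-≤ ℓ (s≤s {n = ℓ′} z≤n)) (≤-reflexive (cong (ℓ +_) (sym (+-identityʳ ℓ))))
          ℓ^k≤f : ℓ ^ k ≤ f
          ℓ^k≤f = climbs ℓ k (s≤s z≤n) (subst (_< s) (dense⇒ ℓ) P)
          powers : (ℓ ^ b) ^ suc k ≤ (2 ^ S) ^ suc k
          powers = *-cancelʳ-≤ _ _ (n ^ b) {{m^n≢0 n b}} (begin
            (ℓ ^ b) ^ suc k * n ^ b          ≡⟨ cong (_* n ^ b) (trans (^-*-assoc ℓ b (suc k)) (trans (cong (ℓ ^_) (*-comm b (suc k))) (sym (^-*-assoc ℓ (suc k) b)))) ⟩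
            (ℓ ^ suc k) ^ b * n ^ b          ≡⟨ sym (*-^ (ℓ ^ suc k) n b) ⟩
            (ℓ ^ suc k * n) ^ b              ≤⟨ ^-monoˡ-≤ b (≤-trans (*-monoˡ-≤ n (≤-trans (≤-reflexive (sym (*-identityˡ _))) (*-monoˡ-≤ (ℓ ^ suc k) 1≤A))) (<⇒≤ P)) ⟩
            s ^ b                            ≤⟨ s≼U ⟩
            2 ^ U * n ^ b                    ≤⟨ *-monoˡ-≤ (n ^ b) (^-monoʳ-≤ 2 (≤-trans U≤Sk (*-monoʳ-≤ S (n≤1+n k)))) ⟩
            2 ^ (S * suc k) * n ^ b          ≡⟨ cong (_* n ^ b) (sym (^-*-assoc 2 S (suc k))) ⟩
            (2 ^ S) ^ suc k * n ^ b          ∎)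

      l≼ : l ≼ (b + W) + (b + W)
      l≼ = ≼-* {E = b + W} {b + W} (log M≼) (log M≼)

      exponent : ℕ
      exponent = 14 * b + ((b + W) + (b + W)) + ((b + W) + (b + W)) + k * (2 * b + ((b + W) + (b + W))) + suc k * b + S

      constant≼ : ∀ {ℓ} → ℓ ≼ S → A * 2 ^ suc k * ℓ ≼ exponent
      constant≼ {ℓ} ℓ≼S = ≼-* {A * 2 ^ suc k} {ℓ}
        (≼-* {A} {2 ^ suc k}
          (≼-* {10240 * l * l} {(4 * l) ^ k}
            (≼-* {10240 * l} {l} (≼-* {10240} {l} 10240≼ l≼) l≼)
            (≼-^ {4 * l} k (≼-* {4} {l} (≼-^ {2} 2 2≼b) l≼)))
          (≼-^ {2} (suc k) 2≼b))
        ℓ≼S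
        where
        10240≼ : 10240 ≼ 14 * b
        -- 10240 + 6144 = 2^14.
        10240≼ = log (≤-trans (^-monoˡ-≤ b (m≤m+n 10240 6144)) (bound (≼-^ 14 2≼b)))

      -- Since b ≤ 2W, every constant factor is paid for in units of W, and k W ≤ S + W bounds what
      -- is raised to the power k. The total 54W + 13S with W ≤ S is the origin of the constant 67
      -- in the theorem.
      exponent≤ : exponent ≤ 67 * S
      exponent≤ = begin
        exponent                                  ≡⟨ e₁ b W k S ⟩
        19 * b + 5 * k * b + 4 * W + 2 * (k * W) + S
          ≤⟨ +-monoˡ-≤ S (+-monoˡ-≤ (2 * (k * W)) (+-monoˡ-≤ (4 * W) (+-mono-≤ (*-monoʳ-≤ 19 b≤2W) (*-monoʳ-≤ (5 * k) b≤2W)))) ⟩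
        19 * (2 * W) + 5 * k * (2 * W) + 4 * W + 2 * (k * W) + S
          ≡⟨ e₂ W k S ⟩
        42 * W + 12 * (k * W) + S                 ≤⟨ +-monoˡ-≤ S (+-monoʳ-≤ (42 * W) (*-monoʳ-≤ 12 kW≤)) ⟩
        42 * W + 12 * (S + W) + S                 ≡⟨ e₃ W S ⟩
        54 * W + 13 * S                           ≤⟨ +-monoˡ-≤ (13 * S) (*-monoʳ-≤ 54 W≤S) ⟩
        54 * S + 13 * S                           ≡⟨ sym (*-distribʳ-+ S 54 13) ⟩
        67 * S                                    ∎
        where
        e₁ : ∀ b W k S → 14 * b + ((b + W) + (b + W)) + ((b + W) + (b + W)) + k * (2 * b + ((b + W) + (b + W))) + suc k * b + S ≡
                         19 * b + 5 * k * b + 4 * W + 2 * (k * W) + S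
        e₁ = solve-∀
        e₂ : ∀ W k S → 19 * (2 * W) + 5 * k * (2 * W) + 4 * W + 2 * (k * W) + S ≡ 42 * W + 12 * (k * W) + S
        e₂ = solve-∀
        e₃ : ∀ W S → 42 * W + 12 * (S + W) + S ≡ 54 * W + 13 * S
        e₃ = solve-∀

      large-S : s ^ b ≤ f ^ b * 2 ^ (67 * S) * n ^ b
      large-S = conclude choose
        where
        conclude : (∃ λ ℓ → ℓ ≼ S × Reached ℓ) → s ^ b ≤ f ^ b * 2 ^ (67 * S) * n ^ b
        conclude (ℓ , ℓ≼S , reached) = begin
          s ^ b                                       ≤⟨ ^-monoˡ-≤ b reached ⟩
          (A * 2 ^ suc k * ℓ * f * n) ^ b             ≡⟨ trans (*-^ (A * 2 ^ suc k * ℓ * f) n b) (cong (_* n ^ b) (*-^ (A * 2 ^ suc k * ℓ) f b)) ⟩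
          (A * 2 ^ suc k * ℓ) ^ b * f ^ b * n ^ b     ≤⟨ *-monoˡ-≤ (n ^ b) (*-monoˡ-≤ (f ^ b) (≤-trans (bound (constant≼ ℓ≼S)) (^-monoʳ-≤ 2 exponent≤))) ⟩
          2 ^ (67 * S) * f ^ b * n ^ b                ≡⟨ cong (_* n ^ b) (*-comm (2 ^ (67 * S)) (f ^ b)) ⟩
          f ^ b * 2 ^ (67 * S) * n ^ b                ∎

    balance : s ^ b ≤ f ^ b * 2 ^ (67 * S) * n ^ b
    balance with S <? W
    ... | yes lt = small-S lt
    ... | no ¬lt = large-S (≮⇒≥ ¬lt)

  -- Rational bounds for the nested logarithms

  n<2^n : ∀ n → n < 2 ^ n
  n<2^n zero    = s≤s z≤n
  n<2^n (suc n) = begin-strict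
    suc n              ≡⟨ +-comm 1 n ⟩
    n + 1              <⟨ +-mono-<-≤ (n<2^n n) (m^n>0 2 n) ⟩
    2 ^ n + 2 ^ n      ≡⟨ cong (2 ^ n +_) (sym (+-identityʳ (2 ^ n))) ⟩
    2 ^ suc n          ∎
    where open ≤-Reasoning

  -- M ≈ 2 log₂ n rather than log₂ n: for n = 3 the bound M ≥ 3 is what keeps
  -- log log n away from 0.
  square-log : ∀ n → 3 ≤ n → ∃ λ M → 3 ≤ M × 2 ^ M ≤ n * n × n < 2 ^ M
  square-log n 3≤n with dyadic (n * n) (n * n) (<-trans (n<2^n (n * n)) (^-monoʳ-< 2 (s≤s (s≤s z≤n)) (n<1+n (n * n))))
  ... | i , lower , upper = M , 3≤M , ≤-trans lower (≤-reflexive (m≥n⇒m⊔n≡m 1≤n²)) , *-cancelˡ-< 2 _ _ (begin-strict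
      2 * n              ≤⟨ *-monoˡ-≤ n (≤-trans (n≤1+n 2) 3≤n) ⟩
      n * n              <⟨ upper ⟩
      2 * 2 ^ M          ∎)
    where
    open ≤-Reasoning
    M = toℕ i
    9≤n² : 9 ≤ n * n
    9≤n² = *-mono-≤ 3≤n 3≤n
    1≤n² : 1 ≤ n * n
    1≤n² = ≤-trans (s≤s z≤n) 9≤n²
    3≤M : 3 ≤ M
    3≤M = 2^-cancel-≤ {3} {M} (≮⇒≥ λ small → <⇒≱ upper (≤-trans (*-monoʳ-≤ 2 (pow≤4 M small)) (≤-trans (n≤1+n 8) 9≤n²)))
      where
      pow≤4 : ∀ M → 2 ^ M < 8 → 2 ^ M ≤ 4
      pow≤4 0 _ = s≤s z≤n
      pow≤4 1 _ = s≤s (s≤s z≤n)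
      pow≤4 2 _ = ≤-refl
      pow≤4 (suc (suc (suc M))) lt = contradiction lt (≤⇒≯ (^-monoʳ-≤ 2 {3} {3 + M} (s≤s (s≤s (s≤s z≤n)))))

  -- un / ud bounds log d, R / e bounds log n, wn / wd bounds log log n, sn / sd is
  -- the square root, xn / xd the exponent, and rn / rd exceeds 2 to that exponent.
  module Cuts (n s f : ℕ) .{{_ : NonZero n}} (3≤n : 3 ≤ n) (1≤s : 1 ≤ s) (1≤f : 1 ≤ f)
    (climbs : ∀ ℓ L j → 1 ≤ ℓ → n < 2 ^ suc L →
      2 * ((4 * (suc L * suc L) * ℓ) ^ j * (80 * (8 * (suc L * suc L)) * (8 * (suc L * suc L)) * ℓ) * n) < s →
      ℓ ^ j ≤ f)
    (un ud : ℕ) .{{_ : NonZero ud}} (log-d : s ^ ud ≤ 2 ^ un * n ^ ud)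
    (R e : ℕ) .{{_ : NonZero e}} (log-n : n ^ e ≤ 2 ^ R)
    (wn wd : ℕ) .{{_ : NonZero wd}} (log-log-n : R ^ wd ≤ 2 ^ wn * e ^ wd)
    (sn sd : ℕ) .{{_ : NonZero sd}} (root : un * wn * (sd * sd) ≤ sn * sn * (ud * wd))
    (xn xd : ℕ) .{{_ : NonZero xd}} (scaled : 67 * sn * xd ≤ xn * sd)
    (rn rd : ℕ) (exponential : 2 ^ xn * rd ^ xd ≤ rn ^ xd)
    where
    open ≤-Reasoning

    b U W S : ℕ
    b = ud * wd * sd
    U = un * wd * sd
    W = wn * ud * sd
    S = sn * ud * wd

    instance
      ud*wd≢0 : NonZero (ud * wd)
      ud*wd≢0 = m*n≢0 ud wd
      b≢0 : NonZero b
      b≢0 = m*n≢0 (ud * wd) sd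

    s≼U : s ^ b ≤ 2 ^ U * n ^ b
    s≼U = begin
      s ^ b                               ≡⟨ cong (s ^_) (*-assoc ud wd sd) ⟩
      s ^ (ud * (wd * sd))                ≡⟨ sym (^-*-assoc s ud (wd * sd)) ⟩
      (s ^ ud) ^ (wd * sd)                ≤⟨ ^-monoˡ-≤ (wd * sd) log-d ⟩
      (2 ^ un * n ^ ud) ^ (wd * sd)       ≡⟨ *-^ (2 ^ un) (n ^ ud) (wd * sd) ⟩
      (2 ^ un) ^ (wd * sd) * (n ^ ud) ^ (wd * sd)
        ≡⟨ cong₂ _*_ (trans (^-*-assoc 2 un (wd * sd)) (cong (2 ^_) (sym (*-assoc un wd sd))))
                     (trans (^-*-assoc n ud (wd * sd)) (cong (n ^_) (sym (*-assoc ud wd sd)))) ⟩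
      2 ^ U * n ^ b                       ∎

    UW≤S² : U * W ≤ S * S
    UW≤S² = begin
      U * W                                       ≡⟨ e₁ un ud wn wd sd ⟩
      un * wn * (sd * sd) * (ud * wd)             ≤⟨ *-monoˡ-≤ (ud * wd) root ⟩
      sn * sn * (ud * wd) * (ud * wd)             ≡⟨ e₂ sn ud wd ⟩
      S * S                                       ∎
      where
      e₁ : ∀ un ud wn wd sd → un * wd * sd * (wn * ud * sd) ≡ un * wn * (sd * sd) * (ud * wd)
      e₁ = solve-∀
      e₂ : ∀ sn ud wd → sn * sn * (ud * wd) * (ud * wd) ≡ sn * ud * wd * (sn * ud * wd)
      e₂ = solve-∀

    module _ (M : ℕ) (3≤M : 3 ≤ M) (M-lower : 2 ^ M ≤ n * n) where

      Me≤2R : M * e ≤ 2 * R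
      Me≤2R = 2^-cancel-≤ (begin
        2 ^ (M * e)          ≡⟨ sym (^-*-assoc 2 M e) ⟩
        (2 ^ M) ^ e          ≤⟨ ^-monoˡ-≤ e M-lower ⟩
        (n * n) ^ e          ≡⟨ *-^ n n e ⟩
        n ^ e * n ^ e        ≤⟨ *-mono-≤ log-n log-n ⟩
        2 ^ R * 2 ^ R        ≡⟨ sym (^-distribˡ-+-* 2 R R) ⟩
        2 ^ (R + R)          ≡⟨ cong (λ x → 2 ^ (R + x)) (sym (+-identityʳ R)) ⟩
        2 ^ (2 * R)          ∎)

      M^wd≤ : M ^ wd ≤ 2 ^ (wd + wn)
      M^wd≤ = *-cancelʳ-≤ _ _ (e ^ wd) {{m^n≢0 e wd}} (begin
        M ^ wd * e ^ wd                  ≡⟨ sym (*-^ M e wd) ⟩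
        (M * e) ^ wd                     ≤⟨ ^-monoˡ-≤ wd Me≤2R ⟩
        (2 * R) ^ wd                     ≡⟨ *-^ 2 R wd ⟩
        2 ^ wd * R ^ wd                  ≤⟨ *-monoʳ-≤ (2 ^ wd) log-log-n ⟩
        2 ^ wd * (2 ^ wn * e ^ wd)       ≡⟨ sym (*-assoc (2 ^ wd) (2 ^ wn) (e ^ wd)) ⟩
        2 ^ wd * 2 ^ wn * e ^ wd         ≡⟨ cong (_* e ^ wd) (sym (^-distribˡ-+-* 2 wd wn)) ⟩
        2 ^ (wd + wn) * e ^ wd           ∎)

      -- From M² ≥ 9 > 2³ one has log M > 3/2, while log M ≤ 1 + wn/wd; so wn/wd is at least 1/2.
      wd≤2wn : wd ≤ 2 * wn
      wd≤2wn = +-cancelˡ-≤ (2 * wd) _ _ (2^-cancel-≤ (begin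
        2 ^ (2 * wd + wd)              ≡⟨ cong (2 ^_) (+-comm (2 * wd) wd) ⟩
        2 ^ (3 * wd)                   ≡⟨ sym (^-*-assoc 2 3 wd) ⟩
        8 ^ wd                         ≤⟨ ^-monoˡ-≤ wd (≤-trans (n≤1+n 8) (*-mono-≤ 3≤M 3≤M)) ⟩
        (M * M) ^ wd                   ≡⟨ *-^ M M wd ⟩
        M ^ wd * M ^ wd                ≤⟨ *-mono-≤ M^wd≤ M^wd≤ ⟩
        2 ^ (wd + wn) * 2 ^ (wd + wn)  ≡⟨ sym (^-distribˡ-+-* 2 (wd + wn) (wd + wn)) ⟩
        2 ^ (wd + wn + (wd + wn))      ≡⟨ cong (2 ^_) (e₁ wd wn) ⟩
        2 ^ (2 * wd + 2 * wn)          ∎))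
        where
        e₁ : ∀ a b → a + b + (a + b) ≡ 2 * a + 2 * b
        e₁ = solve-∀

      M≼ : M ^ b ≤ 2 ^ (b + W)
      M≼ = begin
        M ^ b                              ≡⟨ cong (M ^_) (e₁ ud wd sd) ⟩
        M ^ (wd * (ud * sd))               ≡⟨ sym (^-*-assoc M wd (ud * sd)) ⟩
        (M ^ wd) ^ (ud * sd)               ≤⟨ ^-monoˡ-≤ (ud * sd) M^wd≤ ⟩
        (2 ^ (wd + wn)) ^ (ud * sd)        ≡⟨ ^-*-assoc 2 (wd + wn) (ud * sd) ⟩
        2 ^ ((wd + wn) * (ud * sd))        ≡⟨ cong (2 ^_) (e₂ ud wd wn sd) ⟩
        2 ^ (b + W)                        ∎
        where
        e₁ : ∀ ud wd sd → ud * wd * sd ≡ wd * (ud * sd)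
        e₁ = solve-∀
        e₂ : ∀ ud wd wn sd → (wd + wn) * (ud * sd) ≡ ud * wd * sd + wn * ud * sd
        e₂ = solve-∀

      b≤2W : b ≤ 2 * W
      b≤2W = begin
        b                        ≡⟨ e₁ ud wd sd ⟩
        wd * (ud * sd)           ≤⟨ *-monoˡ-≤ (ud * sd) wd≤2wn ⟩
        2 * wn * (ud * sd)       ≡⟨ e₂ ud wn sd ⟩
        2 * W                    ∎
        where
        e₁ : ∀ ud wd sd → ud * wd * sd ≡ wd * (ud * sd)
        e₁ = solve-∀
        e₂ : ∀ ud wn sd → 2 * wn * (ud * sd) ≡ 2 * (wn * ud * sd)
        e₂ = solve-∀

    balanced : s ^ b ≤ f ^ b * 2 ^ (67 * S) * n ^ b
    balanced with square-log n 3≤n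
    ... | suc L , 3≤M , lower , upper = Balance.balance n s f (suc L) 1≤s 1≤f
            (λ ℓ j 1≤ℓ → climbs ℓ L j 1≤ℓ upper) (s≤s z≤n) b U W S s≼U
            (M≼ (suc L) 3≤M lower) (b≤2W (suc L) 3≤M lower) UW≤S²

    67Sxd≤ : 67 * S * xd ≤ xn * b
    67Sxd≤ = begin
      67 * S * xd                    ≡⟨ e₁ sn ud wd xd ⟩
      67 * sn * xd * (ud * wd)       ≤⟨ *-monoˡ-≤ (ud * wd) scaled ⟩
      xn * sd * (ud * wd)            ≡⟨ e₂ xn sd ud wd ⟩
      xn * b                         ∎
      where
      e₁ : ∀ sn ud wd xd → 67 * (sn * ud * wd) * xd ≡ 67 * sn * xd * (ud * wd)
      e₁ = solve-∀
      e₂ : ∀ xn sd ud wd → xn * sd * (ud * wd) ≡ xn * (ud * wd * sd)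
      e₂ = solve-∀

    conclusion : s * rd ≤ f * rn * n
    -- The power b · xd clears both the denominator b of `balanced` and the denominator xd of the
    -- exponent.
    conclusion = ^-cancelˡ-≤ (b * xd) {{m*n≢0 b xd}} (begin
      (s * rd) ^ (b * xd)
        ≡⟨ trans (*-^ s rd (b * xd)) (cong (_* rd ^ (b * xd)) (sym (^-*-assoc s b xd))) ⟩
      (s ^ b) ^ xd * rd ^ (b * xd)
        ≤⟨ *-monoˡ-≤ (rd ^ (b * xd)) (^-monoˡ-≤ xd balanced) ⟩
      (f ^ b * 2 ^ (67 * S) * n ^ b) ^ xd * rd ^ (b * xd)
        ≡⟨ cong (_* rd ^ (b * xd)) (trans (*-^ (f ^ b * 2 ^ (67 * S)) (n ^ b) xd) (cong₂ _*_ (*-^ (f ^ b) (2 ^ (67 * S)) xd) (^-*-assoc n b xd))) ⟩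
      (f ^ b) ^ xd * (2 ^ (67 * S)) ^ xd * n ^ (b * xd) * rd ^ (b * xd)
        ≡⟨ cong₂ (λ p q → p * q * n ^ (b * xd) * rd ^ (b * xd)) (^-*-assoc f b xd) (^-*-assoc 2 (67 * S) xd) ⟩
      f ^ (b * xd) * 2 ^ (67 * S * xd) * n ^ (b * xd) * rd ^ (b * xd)
        ≡⟨ e₁ (f ^ (b * xd)) (2 ^ (67 * S * xd)) (n ^ (b * xd)) (rd ^ (b * xd)) ⟩
      f ^ (b * xd) * (2 ^ (67 * S * xd) * rd ^ (b * xd)) * n ^ (b * xd)
        ≤⟨ *-monoˡ-≤ (n ^ (b * xd)) (*-monoʳ-≤ (f ^ (b * xd)) power) ⟩
      f ^ (b * xd) * rn ^ (b * xd) * n ^ (b * xd)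
        ≡⟨ sym (trans (*-^ (f * rn) n (b * xd)) (cong (_* n ^ (b * xd)) (*-^ f rn (b * xd)))) ⟩
      (f * rn * n) ^ (b * xd) ∎)
      where
      e₁ : ∀ f t n r → f * t * n * r ≡ f * (t * r) * n
      e₁ = solve-∀
      power : 2 ^ (67 * S * xd) * rd ^ (b * xd) ≤ rn ^ (b * xd)
      power = begin
        2 ^ (67 * S * xd) * rd ^ (b * xd)      ≤⟨ *-monoˡ-≤ (rd ^ (b * xd)) (^-monoʳ-≤ 2 67Sxd≤) ⟩
        2 ^ (xn * b) * rd ^ (b * xd)           ≡⟨ cong₂ _*_ (sym (^-*-assoc 2 xn b)) (trans (cong (rd ^_) (*-comm b xd)) (sym (^-*-assoc rd xd b))) ⟩
        (2 ^ xn) ^ b * (rd ^ xd) ^ b           ≡⟨ sym (*-^ (2 ^ xn) (rd ^ xd) b) ⟩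
        (2 ^ xn * rd ^ xd) ^ b                 ≤⟨ ^-monoˡ-≤ b exponential ⟩
        (rn ^ xd) ^ b                          ≡⟨ trans (^-*-assoc rn xd b) (cong (rn ^_) (*-comm xd b)) ⟩
        rn ^ (b * xd)                          ∎

open MonotonePaths

open import Data.Integer.Base as ℤ using (+_; -[1+_])
import Data.Integer.Properties as ℤₚ
open import Data.Nat.Base as ℕ using (zero; suc; z≤n; s≤s)
import Data.Nat.Properties as ℕₚ
open import Data.Nat.Tactic.RingSolver using (solve-∀)
open import Data.Product.Base using (∃; _,_)
open import Data.Rational.Base using (ℚ; 0ℚ; _<_; _≤_)
open import Data.Rational.Base
  using (mkℚ; _/_; _*_; ↥_; ↧ₙ_; toℚᵘ; *≤*; +-*-rawSemiring; positive)
import Data.Rational.Properties as ℚₚ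
open import Data.Rational.Unnormalised.Base as ℚᵘ using (mkℚᵘ; _≃_)
import Data.Rational.Unnormalised.Properties as ℚᵘₚ
open import Algebra.Definitions.RawSemiring +-*-rawSemiring using (_^_)
open import Relation.Binary.PropositionalEquality
open import Relation.Nullary.Negation.Core using (contradiction)

-- Rational numbers as quotients of naturals

-- The fraction need not be in lowest terms, so products and powers are formed without normalising.
record Frac (p : ℚ) (a b : ℕ) : Set where
  constructor frac
  field
    {{nonZero}} : NonZero b
    equal        : toℚᵘ p ≃ (+ a ℚᵘ./ b)
open Frac

frac-/ : ∀ a b .{{_ : NonZero b}} → Frac (+ a / b) a b
frac-/ a b@(suc b-1) = frac (ℚₚ.toℚᵘ-fromℚᵘ (mkℚᵘ (+ a) b-1))

frac-* : ∀ {p q a b c d} → Frac p a b → Frac q c d → Frac (p * q) (a ℕ.* c) (b ℕ.* d)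
frac-* {p} {q} {a} {b@(suc _)} {c} {d@(suc _)} (frac p≃) (frac q≃) =
  frac (ℚᵘₚ.≃-trans (ℚₚ.toℚᵘ-homo-* p q) (ℚᵘₚ.≃-trans (ℚᵘₚ.*-cong p≃ q≃)
    (ℚᵘₚ.≃-reflexive (cong (ℚᵘ._/ (b ℕ.* d)) (sym (ℤₚ.pos-* a c))))))

frac-^ : ∀ {p a b} k → Frac p a b → Frac (p ^ k) (a ℕ.^ k) (b ℕ.^ k)
frac-^ zero    P = frac ℚᵘₚ.≃-refl
frac-^ (suc k) P = frac-* P (frac-^ k P)

frac-≤ : ∀ {p q a b c d} → Frac p a b → Frac q c d → p ≤ q → a ℕ.* d ℕ.≤ c ℕ.* b
frac-≤ {a = a} {b@(suc _)} {c} {d@(suc _)} (frac p≃) (frac q≃) p≤q =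
  ℤₚ.drop‿+≤+ (subst₂ ℤ._≤_ (sym (ℤₚ.pos-* a d)) (sym (ℤₚ.pos-* c b))
    (ℚᵘₚ.drop-*≤* (ℚᵘₚ.≤-respˡ-≃ p≃ (ℚᵘₚ.≤-respʳ-≃ q≃ (ℚₚ.toℚᵘ-mono-≤ p≤q)))))

frac-< : ∀ {p q a b c d} → Frac p a b → Frac q c d → p < q → a ℕ.* d ℕ.< c ℕ.* b
frac-< {a = a} {b@(suc _)} {c} {d@(suc _)} (frac p≃) (frac q≃) p<q =
  ℤₚ.drop‿+<+ (subst₂ ℤ._<_ (sym (ℤₚ.pos-* a d)) (sym (ℤₚ.pos-* c b))
    (ℚᵘₚ.drop-*<* (ℚᵘₚ.<-respˡ-≃ p≃ (ℚᵘₚ.<-respʳ-≃ q≃ (ℚₚ.toℚᵘ-mono-< p<q)))))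

≤-frac : ∀ {p q a b c d} → Frac p a b → Frac q c d → a ℕ.* d ℕ.≤ c ℕ.* b → p ≤ q
≤-frac {a = a} {b@(suc _)} {c} {d@(suc _)} (frac p≃) (frac q≃) le =
  ℚₚ.toℚᵘ-cancel-≤ (ℚᵘₚ.≤-respˡ-≃ (ℚᵘₚ.≃-sym p≃) (ℚᵘₚ.≤-respʳ-≃ (ℚᵘₚ.≃-sym q≃)
    (ℚᵘ.*≤* (subst₂ ℤ._≤_ (ℤₚ.pos-* a d) (ℤₚ.pos-* c b) (ℤ.+≤+ le)))))

nonNegative-frac : ∀ {q} → 0ℚ ≤ q → ∃ λ c → ↥ q ≡ + c × Frac q c (↧ₙ q)
nonNegative-frac {mkℚ (+ c) d-1 _}   _         = c , refl , frac ℚᵘₚ.≃-refl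
nonNegative-frac {mkℚ -[1+ _ ] _ _} (*≤* ())

frac≥0 : ∀ {p a b} → Frac p a b → 0ℚ ≤ p
frac≥0 P = ≤-frac (frac-/ 0 1) P z≤n

fromℕ-frac : ∀ k → Frac (fromℕ k) k 1
fromℕ-frac k = frac-/ k 1

2^-frac : ∀ k → Frac (2^ (+ k)) (2 ℕ.^ k) 1
2^-frac k = subst (Frac (2^ (+ k)) (2 ℕ.^ k)) (ℕₚ.^-zeroˡ k) (frac-^ {a = 2} {1} k (frac-/ 2 1))

½^-frac : ∀ k → Frac (2^ -[1+ k ]) 1 (2 ℕ.^ suc k)
½^-frac k = subst (λ a → Frac (2^ -[1+ k ]) a (2 ℕ.^ suc k)) (ℕₚ.^-zeroˡ (suc k)) (frac-^ {a = 1} {2} (suc k) (frac ℚᵘₚ.≃-refl))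

-- A number at least 1 has no negative upper bound on its logarithm: some power of it would be at
-- most 1/2. Hence the numerator of `q` is a natural number.
log≤-frac : ∀ {r a b} q → Frac r a b → b ℕ.≤ a → Log≤ r q →
            ∃ λ m → Frac q m (↧ₙ q) × a ℕ.^ (↧ₙ q) ℕ.≤ 2 ℕ.^ m ℕ.* b ℕ.^ (↧ₙ q)
log≤-frac {r} {a} {b} q@(mkℚ (+ m) d-1 _) P b≤a log = m , frac ℚᵘₚ.≃-refl ,
  subst (ℕ._≤ 2 ℕ.^ m ℕ.* b ℕ.^ suc d-1) (ℕₚ.*-identityʳ (a ℕ.^ suc d-1)) (frac-≤ (frac-^ {a = a} {b} (suc d-1) P) (2^-frac m) log)
log≤-frac {r} {a} {b} q@(mkℚ -[1+ m ] d-1 _) P b≤a log = contradiction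
  (ℕₚ.≤-trans (frac-≤ (frac-^ {a = a} {b} (suc d-1) P) (½^-frac m) log) (ℕₚ.≤-reflexive (ℕₚ.*-identityˡ (b ℕ.^ suc d-1))))
  (ℕₚ.<⇒≱ (begin-strict
    b ℕ.^ suc d-1                       ≤⟨ ℕₚ.^-monoˡ-≤ (suc d-1) b≤a ⟩
    a ℕ.^ suc d-1                       ≡⟨ ℕₚ.*-identityʳ (a ℕ.^ suc d-1) ⟨
    a ℕ.^ suc d-1 ℕ.* 1                 <⟨ ℕₚ.*-monoʳ-< (a ℕ.^ suc d-1) {{ℕₚ.m^n≢0 a (suc d-1) {{ℕ.>-nonZero (ℕₚ.≤-trans (ℕ.>-nonZero⁻¹ b {{nonZero P}}) b≤a)}}}}
                                             (ℕₚ.≤-trans (s≤s (s≤s z≤n)) (ℕₚ.^-monoʳ-≤ 2 {1} {suc m} (s≤s z≤n))) ⟩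
    a ℕ.^ suc d-1 ℕ.* 2 ℕ.^ suc m       ∎))
  where open ℕₚ.≤-Reasoning

≥log-frac : ∀ {r a b c} q → Frac r a b → ↥ q ≡ + c → Log≥ r q → 2 ℕ.^ c ℕ.* b ℕ.^ (↧ₙ q) ℕ.≤ a ℕ.^ (↧ₙ q)
≥log-frac {r} {a} {b} {c} q P eq log =
  subst (2 ℕ.^ c ℕ.* b ℕ.^ (↧ₙ q) ℕ.≤_) (ℕₚ.*-identityʳ (a ℕ.^ (↧ₙ q)))
    (frac-≤ (2^-frac c) (frac-^ {a = a} {b} (↧ₙ q) P) (subst (λ z → 2^ z ≤ r ^ ↧ₙ q) eq log))

log-below : ∀ {s b a n} k m .{{_ : NonZero b}} → s ℕ.* b ℕ.≤ a ℕ.* n →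
            a ℕ.^ k ℕ.≤ 2 ℕ.^ m ℕ.* b ℕ.^ k → s ℕ.^ k ℕ.≤ 2 ℕ.^ m ℕ.* n ℕ.^ k
log-below {s} {b} {a} {n} k m below log = ℕₚ.*-cancelʳ-≤ _ _ (b ℕ.^ k) {{ℕₚ.m^n≢0 b k}} (begin
  s ℕ.^ k ℕ.* b ℕ.^ k                    ≡⟨ sym (*-^ s b k) ⟩
  (s ℕ.* b) ℕ.^ k                        ≤⟨ ℕₚ.^-monoˡ-≤ k below ⟩
  (a ℕ.* n) ℕ.^ k                        ≡⟨ *-^ a n k ⟩
  a ℕ.^ k ℕ.* n ℕ.^ k                    ≤⟨ ℕₚ.*-monoˡ-≤ (n ℕ.^ k) log ⟩
  2 ℕ.^ m ℕ.* b ℕ.^ k ℕ.* n ℕ.^ k        ≡⟨ swap (2 ℕ.^ m) (b ℕ.^ k) (n ℕ.^ k) ⟩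
  2 ℕ.^ m ℕ.* n ℕ.^ k ℕ.* b ℕ.^ k        ∎)
  where
  open ℕₚ.≤-Reasoning
  swap : ∀ x y z → x ℕ.* y ℕ.* z ≡ x ℕ.* z ℕ.* y
  swap = solve-∀

denominator≤numerator : ∀ {s n a b} .{{_ : NonZero n}} → n ℕ.≤ s → s ℕ.* b ℕ.≤ a ℕ.* n → b ℕ.≤ a
denominator≤numerator {s} {n} {a} {b} n≤s le = ℕₚ.*-cancelʳ-≤ b a n (begin
  b ℕ.* n     ≡⟨ ℕₚ.*-comm b n ⟩
  n ℕ.* b     ≤⟨ ℕₚ.*-monoˡ-≤ b n≤s ⟩
  s ℕ.* b     ≤⟨ le ⟩
  a ℕ.* n     ∎)
  where open ℕₚ.≤-Reasoning

theorem1p2 : ∃[ C ] 0ℚ < C ×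
    ((n : ℕ) .{{_ : NonZero n}} (G : Graph n) →
    let d = averageDegree G in
    fromℕ 2 ≤ d →
    (f : ℕ) → IsAltitude G f →
    fromℕ f ≥ᴿ d ÷ exp₂ (real C · √ (log₂ (real d) · log₂ (log₂ (real (fromℕ n))))))
theorem1p2 = fromℕ 67 , ℚₚ.positive⁻¹ (fromℕ 67) , λ
  { n G 2≤d f alt q (r , (0<r , x , (c , σ , 67<c ,
      (0<σ , u , w , (r₁ , d<r₁ , log-d) , (r₂ , (r₃ , n<r₃ , log-n) , log-log-n) , uw≤σ²) , cσ≤x) , 2^x≤r) , qr≤d) →
    bound n G 2≤d f alt q r 0<r x c σ 67<c 0<σ u w r₁ d<r₁ log-d r₂ r₃ n<r₃ log-n log-log-n uw≤σ² cσ≤x 2^x≤r qr≤d }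
  where
  bound : (n : ℕ) .{{_ : NonZero n}} (G : Graph n) → fromℕ 2 ≤ averageDegree G →
          (f : ℕ) → IsAltitude G f →
          ∀ q r → 0ℚ < r → ∀ x c σ → fromℕ 67 < c → 0ℚ < σ →
          ∀ u w r₁ → averageDegree G < r₁ → Log≤ r₁ u →
          ∀ r₂ r₃ → fromℕ n < r₃ → Log≤ r₃ r₂ → Log≤ r₂ w → u * w ≤ σ * σ → c * σ ≤ x → Log≥ r x →
          q * r ≤ averageDegree G → q ≤ fromℕ f
  bound n G 2≤d f alt q r 0<r x c σ 67<c 0<σ u w r₁ d<r₁ log-d r₂ r₃ n<r₃ log-n log-log-n uw≤σ² cσ≤x 2^x≤r qr≤d =
    step₁ (nonNegative-frac (ℚₚ.≤-trans (frac≥0 D) (ℚₚ.<⇒≤ d<r₁)))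
          (nonNegative-frac (ℚₚ.≤-trans (frac≥0 N) (ℚₚ.<⇒≤ n<r₃)))
          (nonNegative-frac (ℚₚ.<⇒≤ 0<σ))
          (nonNegative-frac (ℚₚ.≤-trans (frac≥0 (fromℕ-frac 67)) (ℚₚ.<⇒≤ 67<c)))
          (nonNegative-frac (ℚₚ.<⇒≤ 0<r))
    where
    open ℕₚ.≤-Reasoning
    s : ℕ
    s = degreeSum G
    D : Frac (averageDegree G) s n
    D = frac-/ s n
    N : Frac (fromℕ n) n 1
    N = fromℕ-frac n
    2n≤s : 2 ℕ.* n ℕ.≤ s
    2n≤s = ℕₚ.≤-trans (frac-≤ (fromℕ-frac 2) D 2≤d) (ℕₚ.≤-reflexive (ℕₚ.*-identityʳ s))
    n≤s : n ℕ.≤ s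
    n≤s = ℕₚ.≤-trans (ℕₚ.m≤n*m n 2) 2n≤s
    1≤n : 1 ℕ.≤ n
    1≤n = ℕ.>-nonZero⁻¹ n
    1≤s : 1 ℕ.≤ s
    1≤s = ℕₚ.≤-trans 1≤n n≤s
    3≤n : 3 ℕ.≤ n
    -- A simple graph has degree sum at most n(n - 1), so average degree 2 requires three vertices.
    3≤n = ℕₚ.*-cancelʳ-≤ 3 n n (begin
      3 ℕ.* n             ≡⟨ ℕₚ.+-comm n (2 ℕ.* n) ⟩
      2 ℕ.* n ℕ.+ n       ≤⟨ ℕₚ.+-monoˡ-≤ n 2n≤s ⟩
      s ℕ.+ n             ≤⟨ degreeSum-upper G ⟩
      n ℕ.* n             ∎)
    NonNeg : ℚ → Set
    NonNeg p = ∃ λ a → ↥ p ≡ + a × Frac p a (↧ₙ p)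
    step₁ : NonNeg r₁ → NonNeg r₃ → NonNeg σ → NonNeg c → NonNeg r → q ≤ fromℕ f
    step₁ (a₁ , _ , F₁) (a₃ , _ , F₃) (sn , _ , Fσ) (cn , _ , Fc) (rn , _ , Fr) =
      step₂ (log≤-frac u F₁ (denominator≤numerator n≤s below₁) log-d)
            (log≤-frac r₂ F₃ (denominator≤numerator 1≤n below₃) log-n)
            (nonNegative-frac (ℚₚ.≤-trans (frac≥0 (frac-* Fc Fσ)) cσ≤x))
      where
      below₁ : s ℕ.* ↧ₙ r₁ ℕ.≤ a₁ ℕ.* n
      below₁ = ℕₚ.<⇒≤ (frac-< D F₁ d<r₁)
      below₃ : n ℕ.* ↧ₙ r₃ ℕ.≤ a₃ ℕ.* 1
      below₃ = ℕₚ.<⇒≤ (frac-< N F₃ n<r₃)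
      step₂ : (∃ λ un → Frac u un (↧ₙ u) × a₁ ℕ.^ ↧ₙ u ℕ.≤ 2 ℕ.^ un ℕ.* (↧ₙ r₁) ℕ.^ ↧ₙ u) →
              (∃ λ R → Frac r₂ R (↧ₙ r₂) × a₃ ℕ.^ ↧ₙ r₂ ℕ.≤ 2 ℕ.^ R ℕ.* (↧ₙ r₃) ℕ.^ ↧ₙ r₂) →
              NonNeg x → q ≤ fromℕ f
      step₂ (un , Fu , log₁) (R , F₂ , log₃) (xn , x≡ , Fx) =
        -- The outer logarithm is taken of `r₂`, an upper bound for log n; it is at least 1 because
        -- n ≥ 2, so `w` is not negative either.
        step₃ (log≤-frac w F₂ (2^-cancel-≤ (ℕₚ.≤-trans (ℕₚ.^-monoˡ-≤ (↧ₙ r₂) (ℕₚ.≤-trans (ℕₚ.n≤1+n 2) 3≤n)) log-n′)) log-log-n)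
        where
        log-d′ : s ℕ.^ ↧ₙ u ℕ.≤ 2 ℕ.^ un ℕ.* n ℕ.^ ↧ₙ u
        log-d′ = log-below {s} {↧ₙ r₁} {a₁} {n} (↧ₙ u) un below₁ log₁
        log-n′ : n ℕ.^ ↧ₙ r₂ ℕ.≤ 2 ℕ.^ R
        log-n′ = ℕₚ.≤-trans (log-below {n} {↧ₙ r₃} {a₃} {1} (↧ₙ r₂) R below₃ log₃)
          (ℕₚ.≤-reflexive (trans (cong (2 ℕ.^ R ℕ.*_) (ℕₚ.^-zeroˡ (↧ₙ r₂))) (ℕₚ.*-identityʳ (2 ℕ.^ R))))
        step₃ : (∃ λ wn → Frac w wn (↧ₙ w) × R ℕ.^ ↧ₙ w ℕ.≤ 2 ℕ.^ wn ℕ.* (↧ₙ r₂) ℕ.^ ↧ₙ w) → q ≤ fromℕ f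
        step₃ (wn , Fw , log-log-n′) = ℚₚ.*-cancelʳ-≤-pos r {{positive 0<r}}
          (ℚₚ.≤-trans qr≤d (≤-frac D (frac-* (fromℕ-frac f) Fr) (ℕₚ.≤-trans
            (ℕₚ.≤-reflexive (cong (s ℕ.*_) (ℕₚ.*-identityˡ (↧ₙ r)))) final)))
          where
          scaled : 67 ℕ.* sn ℕ.* ↧ₙ x ℕ.≤ xn ℕ.* ↧ₙ σ
          scaled = ℕₚ.*-cancelʳ-≤ _ _ (↧ₙ c) (begin
            67 ℕ.* sn ℕ.* ↧ₙ x ℕ.* ↧ₙ c       ≡⟨ e₁ sn (↧ₙ x) (↧ₙ c) ⟩
            67 ℕ.* ↧ₙ c ℕ.* (sn ℕ.* ↧ₙ x)     ≤⟨ ℕₚ.*-monoˡ-≤ (sn ℕ.* ↧ₙ x) (ℕₚ.<⇒≤ (frac-< (fromℕ-frac 67) Fc 67<c)) ⟩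
            cn ℕ.* 1 ℕ.* (sn ℕ.* ↧ₙ x)        ≡⟨ e₂ cn sn (↧ₙ x) ⟩
            cn ℕ.* sn ℕ.* ↧ₙ x                ≤⟨ frac-≤ (frac-* Fc Fσ) Fx cσ≤x ⟩
            xn ℕ.* (↧ₙ c ℕ.* ↧ₙ σ)            ≡⟨ e₃ xn (↧ₙ c) (↧ₙ σ) ⟩
            xn ℕ.* ↧ₙ σ ℕ.* ↧ₙ c              ∎)
            where
            e₁ : ∀ a b c → 67 ℕ.* a ℕ.* b ℕ.* c ≡ 67 ℕ.* c ℕ.* (a ℕ.* b)
            e₁ = solve-∀
            e₂ : ∀ a b c → a ℕ.* 1 ℕ.* (b ℕ.* c) ≡ a ℕ.* b ℕ.* c
            e₂ = solve-∀
            e₃ : ∀ a b c → a ℕ.* (b ℕ.* c) ≡ a ℕ.* c ℕ.* b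
            e₃ = solve-∀
          final : s ℕ.* ↧ₙ r ℕ.≤ f ℕ.* rn ℕ.* n
          final = Cuts.conclusion n s f 3≤n 1≤s (altitude-positive G alt 1≤s) (altitude-large G alt)
            un (↧ₙ u) log-d′ R (↧ₙ r₂) log-n′ wn (↧ₙ w) log-log-n′ sn (↧ₙ σ)
            (frac-≤ (frac-* Fu Fw) (frac-* Fσ Fσ) uw≤σ²) xn (↧ₙ x) scaled rn (↧ₙ r) (≥log-frac x Fr x≡ 2^x≤r)
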